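{- Let $M$ be a fixed binary matroid. Then there exist constants $k_M, L_M$ such that if $k \geq k_M$ (with $k$ fixed, independent of $n$) and $m \geq L_M n$, then with probability tending to $1$ as $n\to\infty$ the matroid $\mathcal{M}_{n,m,k}$ contains $M$ as a minor.
   Context: For positive integers $n,m,k$ with $k\le n$, let $\mathbf{A}_{n,m,k}$ be a random $n\times m$ matrix over $\mathbf{GF}_2$ whose columns are independent, each column having exactly $k$ ones in a set of $k$ rows chosen uniformly at random from the $\binom{n}{k}$ possible sets (and zeros elsewhere). Let $\mathcal{M}_{n,m,k}$ be the binary matroid on the set of columns of $\mathbf{A}_{n,m,k}$ whose independent sets are the sets of columns that are linearly independent over $\mathbf{GF}_2$. A matroid $M$ is a minor of a matroid $\mathcal{M}$ if it is isomorphic to a matroid obtained from $\mathcal{M}$ by a sequence of deletions and contractions, where for a matroid on ground set $E$ with independent sets $\mathcal{I}$, the deletion $\mathcal{M}\setminus X$ has ground set $E\setminus X$ and independent sets $\{I\in\mathcal{I}: I\subseteq E\setminus X\}$, and the contraction $\mathcal{M}/X$ (for $X\in\mathcal{I}$) has ground set $E\setminus X$ and independent sets $\{I\subseteq E\setminus X: I\cup X\in\mathcal{I}\}$. -}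

module Defs where

open import Data.Nat using (ℕ; zero; suc; _+_; _*_; _^_; _≤_; _<_)
open import Data.Nat.Combinatorics using (_C_)
open import Data.Bool using (Bool; true; false; _xor_; if_then_else_)
open import Data.Fin using (Fin; zero; suc)
open import Data.Fin.Subset using (Subset; ⊤; ⊥; _∪_; _─_; _∈_; _⊆_; ⁅_⁆; ∣_∣; Nonempty)
open import Data.Vec using (Vec; []; _∷_; replicate; zipWith)
open import Data.List using (List; []; _∷_; length)
open import Data.List.Relation.Unary.All using (All)
open import Data.List.Relation.Unary.Unique.Propositional using (Unique)
open import Data.Product using (Σ; ∃; _×_; _,_)
open import Function using (_∘_)
open import Function.Definitions using (Injective)
open import Relation.Binary.PropositionalEquality using (_≡_; _≢_)
open import Level using (0ℓ) renaming (suc to lsuc)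

-- Vectors over GF(2): a vector in GF(2)^n is a Subset n = Vec Bool n
-- (true = 1, false = 0); addition is coordinatewise xor.
GF2Vec : ℕ → Set
GF2Vec n = Vec Bool n

zeroVec : ∀ {n} → GF2Vec n
zeroVec = replicate _ false

_⊕_ : ∀ {n} → GF2Vec n → GF2Vec n → GF2Vec n
_⊕_ = zipWith _xor_

sumCols : ∀ {n m} → Vec (GF2Vec n) m → Subset m → GF2Vec n
sumCols []         []       = zeroVec
sumCols (c ∷ cols) (b ∷ T) = (if b then c else zeroVec) ⊕ sumCols cols T

-- A set S of columns is linearly independent over GF(2): no nontrivial
-- GF(2)-linear combination (= sum over a nonempty subset T ⊆ S) vanishes.
LinIndep : ∀ {n m} → Vec (GF2Vec n) m → Subset m → Set
LinIndep cols S = ∀ T → T ⊆ S → Nonempty T → sumCols cols T ≢ zeroVec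

record SetSys (u : ℕ) : Set₁ where
  field
    ground : Subset u
    Ind    : Subset u → Set
open SetSys public

columnMatroid : ∀ {n m} → Vec (GF2Vec n) m → SetSys m
columnMatroid cols = record { ground = ⊤ ; Ind = LinIndep cols }

delete : ∀ {u} → SetSys u → Subset u → SetSys u
delete M X = record
  { ground = ground M ─ X
  ; Ind    = λ I → Ind M I × I ⊆ ground M ─ X }

contract : ∀ {u} → SetSys u → Subset u → SetSys u
contract M X = record
  { ground = ground M ─ X
  ; Ind    = λ I → I ⊆ ground M ─ X × Ind M (I ∪ X) }

data Op (u : ℕ) : Set where
  del : Subset u → Op u
  con : Subset u → Op u

applyOps : ∀ {u} → SetSys u → List (Op u) → SetSys u
applyOps M []           = M
applyOps M (del X ∷ os) = applyOps (delete M X) os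
applyOps M (con X ∷ os) = applyOps (contract M X) os

ValidOps : ∀ {u} → SetSys u → List (Op u) → Set
ValidOps M []           = Data.Unit.⊤
  where import Data.Unit
ValidOps M (del X ∷ os) = X ⊆ ground M × ValidOps (delete M X) os
ValidOps M (con X ∷ os) = (X ⊆ ground M × Ind M X) × ValidOps (contract M X) os

image : ∀ {e u} → (Fin e → Fin u) → Subset e → Subset u
image {zero}  f []      = ⊥
image {suc e} f (b ∷ S) = (if b then ⁅ f zero ⁆ else ⊥) ∪ image (f ∘ suc) S

-- Isomorphism of a matroid M on ground set Fin e (all of it) with a set
-- system N: a bijection f : Fin e → ground N carrying independent sets
-- exactly to independent sets.
Iso : ∀ {e u} → SetSys e → SetSys u → Set
Iso {e} {u} M N =
  Σ (Fin e → Fin u) λ f →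
      Injective _≡_ _≡_ f
    × (∀ x → f x ∈ ground N)
    × (∀ y → y ∈ ground N → ∃ λ x → f x ≡ y)
    × (∀ T → T ⊆ ground M → (Ind M T → Ind N (image f T)) × (Ind N (image f T) → Ind M T))

IsMinorOf : ∀ {e u} → SetSys e → SetSys u → Set
IsMinorOf M 𝓜 = Σ (List (Op _)) λ os → ValidOps 𝓜 os × Iso M (applyOps 𝓜 os)

-- "With probability ≥ 1 - p/q, the matroid M_{n,m,k} has M as a minor":
-- the sample space is Vec (Subset n) m with every column of size k (all
-- (n C k)^m outcomes equally likely); we ask for a list of distinct good
-- outcomes whose size is at least (1 - p/q)·(n C k)^m, i.e.
-- q·|good| + p·(n C k)^m ≥ q·(n C k)^m.
ProbMinorAtLeast : ∀ {e} → SetSys e → (n m k p q : ℕ) → Set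
ProbMinorAtLeast M n m k p q =
  Σ (List (Vec (Subset n) m)) λ good →
      Unique good
    × All (λ cols → All' cols × IsMinorOf M (columnMatroid cols)) good
    × q * ((n C k) ^ m) ≤ q * length good + p * ((n C k) ^ m)
  where
    import Data.Vec.Relation.Unary.All as VA
    All' : Vec (Subset n) m → Set
    All' cols = VA.All (λ s → ∣ s ∣ ≡ k) cols

{-# OPTIONS --safe #-}
module Submission where

-- The columns, all drawn independently, are read in two phases. Fix a layout of
-- the rows in r + 1 equal blocks of size about n / k plus a large remainder; rows
-- of block i + 1 are labelled by the i-th unit vector of GF(2)^r, all others by 0,
-- and π is the induced linear map GF(2)^n → GF(2)^r.
--
-- Phase 1 contracts a basis W of the columns seen in ker π. A constant fraction of
-- all k-sets, independent of k, has the form {x, y} ∪ D with x, y in the two sides of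
-- one block and D in the remainder, and such columns lie in ker π. Unless for every
-- block some partner {y} ∪ D is congruent modulo W to half of the points x of that
-- block, a constant fraction of all k-sets enlarges W; as the rank is at most n, a
-- number of columns linear in n suffices (the weight 2^(n - rank W) is a
-- supermartingale).
--
-- After that, any k-set of congruent points is determined modulo W by how many of
-- its points each block receives. For each vector β of GF(2)^r a positive fraction of
-- all k-sets (now depending on k) consists of one such point in block i + 1 for each
-- i in the support of β and further such points in block 0. Phase 2 waits for one of
-- these for β = 0, which is contracted too, and for each column of B. Modulo the
-- contracted columns those are a linear image of the columns of B, while π maps them
-- back to B, so they represent the matroid of B.

open import Defs
open import Data.Nat using (ℕ; zero; suc; _+_; _*_; _^_; _∸_; _≤_; _<_; z≤n; s≤s; NonZero; >-nonZero; _≤′_; ≤′-refl; ≤′-step; _/_; _%_; _≤?_; _≟_)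
import Data.Nat.Properties as ℕₚ
open import Data.Nat.DivMod using (m≡m%n+[m/n]*n; m%n<n; m/n*n≤m; m≥n⇒m/n>0)
open import Data.Nat.Combinatorics using (_C_; nCk+nC[k+1]≡[n+1]C[k+1]; nC1≡n)
open import Data.Nat.ListAction using (sum)
open import Data.Nat.Tactic.RingSolver using (solve-∀)
open import Data.Bool using (Bool; true; false; _xor_; if_then_else_)
import Data.Bool.Properties as Boolₚ
open import Data.Fin using (Fin; zero; suc; _↑ˡ_; combine; remQuot; inject≤)
import Data.Fin.Properties as Finₚ
open import Data.Fin.Subset using (Subset; ⊤; ⊥; _∪_; _─_; _∈_; _⊆_; ⁅_⁆; ∣_∣; Nonempty)
open import Data.Fin.Subset.Properties using (∈⊤; ∉⊥; p─q⊆p; anySubset?; nonempty?; Empty-unique; drop-∷-⊆; x∈⁅y⁆⇒x≡y; x∈⁅x⁆)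
open import Data.List using (List; []; _∷_; length; map; filter; cartesianProduct; cartesianProductWith; allFin)
  renaming (_++_ to _++ₗ_; lookup to lookupₗ)
open import Data.List.Properties using (length-map; length-++; length-tabulate)
open import Data.List.Relation.Unary.Any using (here; there) renaming (index to Any-index)
open import Data.List.Relation.Unary.Any.Properties using (lookup-index)
import Data.List.Relation.Unary.All as ListAll
open import Data.List.Relation.Unary.All using ([]; _∷_)
open import Data.List.Relation.Unary.AllPairs using ([]; _∷_)
open import Data.List.Relation.Unary.Unique.Propositional using (Unique)
import Data.List.Relation.Unary.Unique.Propositional.Properties as Uniqueₚ
open import Data.List.Membership.Propositional using () renaming (_∈_ to _∈ₗ_)
import Data.List.Membership.Propositional.Properties as ∈ₚ
open import Data.Vec using (Vec; []; _∷_; here; there; _++_; lookup; replicate; tabulate; toList) renaming (map to mapᵛ)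
open import Data.Vec.Properties using
  (zipWith-assoc; zipWith-comm; zipWith-identityˡ; zipWith-identityʳ; ≡-dec; ∷-injective; ∷-injectiveˡ; ∷-injectiveʳ;
   lookup-zipWith; lookup-replicate; lookup-++ˡ; lookup∘tabulate; ++-injective; ++-injectiveʳ; tabulate-∘;
   tabulate-cong; []=⇒lookup; lookup⇒[]=; length-toList)
import Data.Vec.Relation.Unary.All as VecAll
import Data.Vec.Relation.Unary.All.Properties as VecAllₚ
open import Data.Vec.Relation.Binary.Pointwise.Inductive using (Pointwise; []; _∷_)
open import Data.Product using (Σ; ∃; _×_; _,_; proj₁; proj₂)
open import Data.Sum using (_⊎_; inj₁; inj₂)
open import Data.Empty using () renaming (⊥ to Empty)
open import Data.Unit using (tt) renaming (⊤ to Unit)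
open import Function using (_∘_; id)
open import Relation.Nullary using (¬_; Dec; yes; no; does; contradiction; ¬?; _×-dec_; _⊎-dec_)
open import Relation.Nullary.Decidable using (decidable-stable)
open import Relation.Unary using (Decidable)
open import Relation.Binary.PropositionalEquality

-- Linear algebra over GF(2): addition, column sums, spans and independence.

⊕-assoc : ∀ {n} (u v w : GF2Vec n) → (u ⊕ v) ⊕ w ≡ u ⊕ (v ⊕ w)
⊕-assoc = zipWith-assoc Boolₚ.xor-assoc

⊕-comm : ∀ {n} (u v : GF2Vec n) → u ⊕ v ≡ v ⊕ u
⊕-comm = zipWith-comm Boolₚ.xor-comm

⊕-identityˡ : ∀ {n} (v : GF2Vec n) → zeroVec ⊕ v ≡ v
⊕-identityˡ = zipWith-identityˡ Boolₚ.xor-identityˡ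

⊕-identityʳ : ∀ {n} (v : GF2Vec n) → v ⊕ zeroVec ≡ v
⊕-identityʳ = zipWith-identityʳ Boolₚ.xor-identityʳ

⊕-self : ∀ {n} (v : GF2Vec n) → v ⊕ v ≡ zeroVec
⊕-self []      = refl
⊕-self (x ∷ v) = cong₂ _∷_ (Boolₚ.xor-same x) (⊕-self v)

⊕-cancelˡ : ∀ {n} (u v : GF2Vec n) → u ⊕ (u ⊕ v) ≡ v
⊕-cancelˡ u v = begin
  u ⊕ (u ⊕ v)  ≡⟨ ⊕-assoc u u v ⟨
  (u ⊕ u) ⊕ v  ≡⟨ cong (_⊕ v) (⊕-self u) ⟩
  zeroVec ⊕ v  ≡⟨ ⊕-identityˡ v ⟩
  v            ∎
  where open ≡-Reasoning

⊕≡0⇒≡ : ∀ {n} (u v : GF2Vec n) → u ⊕ v ≡ zeroVec → u ≡ v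
⊕≡0⇒≡ u v eq = begin
  u            ≡⟨ ⊕-identityʳ u ⟨
  u ⊕ zeroVec  ≡⟨ cong (u ⊕_) eq ⟨
  u ⊕ (u ⊕ v)  ≡⟨ ⊕-cancelˡ u v ⟩
  v            ∎
  where open ≡-Reasoning

⊕-interchange : ∀ {n} (a b c d : GF2Vec n) → (a ⊕ b) ⊕ (c ⊕ d) ≡ (a ⊕ c) ⊕ (b ⊕ d)
⊕-interchange a b c d = begin
  (a ⊕ b) ⊕ (c ⊕ d)  ≡⟨ ⊕-assoc a b (c ⊕ d) ⟩
  a ⊕ (b ⊕ (c ⊕ d))  ≡⟨ cong (a ⊕_) (⊕-assoc b c d) ⟨
  a ⊕ ((b ⊕ c) ⊕ d)  ≡⟨ cong (λ x → a ⊕ (x ⊕ d)) (⊕-comm b c) ⟩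
  a ⊕ ((c ⊕ b) ⊕ d)  ≡⟨ cong (a ⊕_) (⊕-assoc c b d) ⟩
  a ⊕ (c ⊕ (b ⊕ d))  ≡⟨ ⊕-assoc a c (b ⊕ d) ⟨
  (a ⊕ c) ⊕ (b ⊕ d)  ∎
  where open ≡-Reasoning

_≟ᵛ_ : ∀ {n} (u v : GF2Vec n) → Dec (u ≡ v)
_≟ᵛ_ = ≡-dec Boolₚ._≟_

scale-⊕ : ∀ {n} b b′ (c : GF2Vec n) →
          (if b xor b′ then c else zeroVec) ≡ (if b then c else zeroVec) ⊕ (if b′ then c else zeroVec)
scale-⊕ false b′    c = sym (⊕-identityˡ _)
scale-⊕ true  false c = sym (⊕-identityʳ c)
scale-⊕ true  true  c = sym (⊕-self c)

sumCols-⊕ : ∀ {n m} (cols : Vec (GF2Vec n) m) S T → sumCols cols (S ⊕ T) ≡ sumCols cols S ⊕ sumCols cols T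
sumCols-⊕ []         []      []       = sym (⊕-identityˡ _)
sumCols-⊕ (c ∷ cols) (b ∷ S) (b′ ∷ T) =
  trans (cong₂ _⊕_ (scale-⊕ b b′ c) (sumCols-⊕ cols S T)) (⊕-interchange _ _ _ _)

sumCols-0 : ∀ {n m} (cols : Vec (GF2Vec n) m) → sumCols cols zeroVec ≡ zeroVec
sumCols-0 []         = refl
sumCols-0 (c ∷ cols) = trans (⊕-identityˡ _) (sumCols-0 cols)

sumCols-++ : ∀ {n l m} (us : Vec (GF2Vec n) l) (vs : Vec (GF2Vec n) m) S T →
             sumCols (us ++ vs) (S ++ T) ≡ sumCols us S ⊕ sumCols vs T
sumCols-++ []       vs []      T = sym (⊕-identityˡ _)
sumCols-++ (u ∷ us) vs (b ∷ S) T = trans (cong (_ ⊕_) (sumCols-++ us vs S T)) (sym (⊕-assoc _ _ _))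

sumCols-replicate-0 : ∀ {n} m (T : Subset m) → sumCols (replicate m (zeroVec {n})) T ≡ zeroVec
sumCols-replicate-0 zero    []          = refl
sumCols-replicate-0 (suc m) (true  ∷ T) = trans (⊕-identityˡ _) (sumCols-replicate-0 m T)
sumCols-replicate-0 (suc m) (false ∷ T) = trans (⊕-identityˡ _) (sumCols-replicate-0 m T)

sumCols-⁅⁆ : ∀ {n m} (cols : Vec (GF2Vec n) m) i → sumCols cols ⁅ i ⁆ ≡ lookup cols i
sumCols-⁅⁆ (c ∷ cols) zero    = trans (cong (c ⊕_) (sumCols-0 cols)) (⊕-identityʳ c)
sumCols-⁅⁆ (c ∷ cols) (suc i) = trans (⊕-identityˡ _) (sumCols-⁅⁆ cols i)

Span : ∀ {n l} → Vec (GF2Vec n) l → GF2Vec n → Set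
Span ws v = ∃ λ T → sumCols ws T ≡ v

span? : ∀ {n l} (ws : Vec (GF2Vec n) l) v → Dec (Span ws v)
span? ws v = anySubset? (λ T → sumCols ws T ≟ᵛ v)

span-0 : ∀ {n l} (ws : Vec (GF2Vec n) l) → Span ws zeroVec
span-0 ws = zeroVec , sumCols-0 ws

span-⊕ : ∀ {n l} (ws : Vec (GF2Vec n) l) {u v} → Span ws u → Span ws v → Span ws (u ⊕ v)
span-⊕ ws (S , refl) (T , refl) = S ⊕ T , sumCols-⊕ ws S T

span-∷ : ∀ {n l} w (ws : Vec (GF2Vec n) l) {v} → Span ws v → Span (w ∷ ws) v
span-∷ w ws (T , refl) = false ∷ T , ⊕-identityˡ _

span-head : ∀ {n l} w (ws : Vec (GF2Vec n) l) → Span (w ∷ ws) w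
span-head w ws = true ∷ zeroVec , trans (cong (w ⊕_) (sumCols-0 ws)) (⊕-identityʳ w)

-- Stated one vector at a time, since the contracted basis grows by adjoining single columns outside
-- the current span.
Indep : ∀ {n l} → Vec (GF2Vec n) l → Set
Indep []       = Unit
Indep (w ∷ ws) = ¬ Span ws w × Indep ws

indep⇒0 : ∀ {n l} (ws : Vec (GF2Vec n) l) → Indep ws → ∀ T → sumCols ws T ≡ zeroVec → T ≡ zeroVec
indep⇒0 []       _           []          eq = refl
indep⇒0 (w ∷ ws) (w∉ , ind) (true  ∷ T) eq = contradiction (T , sym (⊕≡0⇒≡ w _ eq)) w∉
indep⇒0 (w ∷ ws) (w∉ , ind) (false ∷ T) eq =
  cong (false ∷_) (indep⇒0 ws ind T (trans (sym (⊕-identityˡ _)) eq))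

sumCols-injective : ∀ {n l} (ws : Vec (GF2Vec n) l) → Indep ws →
                    ∀ {S T} → sumCols ws S ≡ sumCols ws T → S ≡ T
sumCols-injective ws ind {S} {T} eq =
  ⊕≡0⇒≡ S T (indep⇒0 ws ind (S ⊕ T)
    (trans (sumCols-⊕ ws S T) (trans (cong (_⊕ sumCols ws T) eq) (⊕-self _))))

nonempty⇒≢⊥ : ∀ {m} {T : Subset m} → Nonempty T → T ≢ ⊥
nonempty⇒≢⊥ (x , x∈T) refl = ∉⊥ x∈T

≢⊥⇒nonempty : ∀ {m} (T : Subset m) → T ≢ ⊥ → Nonempty T
≢⊥⇒nonempty T T≢⊥ = decidable-stable (nonempty? T) (T≢⊥ ∘ Empty-unique)

-- Minors of a column matroid described by contracted and kept columns.

module _ where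

  private
    variable
      n m l e : ℕ
      cols : Vec (GF2Vec n) m
      ws : Vec (GF2Vec n) l
      vs : Vec (GF2Vec n) e

  -- A minor of the column matroid of cols: ws is contracted, vs is kept, the other
  -- columns are deleted.
  data Pick {n : ℕ} : ∀ {m l e} → Vec (GF2Vec n) m → Vec (GF2Vec n) l → Vec (GF2Vec n) e → Set where
    []   : Pick [] [] []
    ctr  : ∀ c → Pick cols ws vs → Pick (c ∷ cols) (c ∷ ws) vs
    keep : ∀ c → Pick cols ws vs → Pick (c ∷ cols) ws (c ∷ vs)
    skip : ∀ c → Pick cols ws vs → Pick (c ∷ cols) ws vs

  -- Coefficients `S` on the kept columns and `T` on the contracted ones are merged into one vector
  -- on all columns, with 0 on the deleted ones.
  embed : ∀ {n m l e} {cols : Vec (GF2Vec n) m} {ws : Vec (GF2Vec n) l} {vs : Vec (GF2Vec n) e} →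
          Pick cols ws vs → Subset e → Subset l → Subset m
  embed []         S       T       = []
  embed (ctr c p)  S       (t ∷ T) = t ∷ embed p S T
  embed (keep c p) (s ∷ S) T       = s ∷ embed p S T
  embed (skip c p) S       T       = false ∷ embed p S T

  skipped : ∀ {n m l e} {cols : Vec (GF2Vec n) m} {ws : Vec (GF2Vec n) l} {vs : Vec (GF2Vec n) e} →
            Pick cols ws vs → Subset m
  skipped []         = []
  skipped (ctr c p)  = false ∷ skipped p
  skipped (keep c p) = false ∷ skipped p
  skipped (skip c p) = true ∷ skipped p

  index : ∀ {n m l e} {cols : Vec (GF2Vec n) m} {ws : Vec (GF2Vec n) l} {vs : Vec (GF2Vec n) e} →
          Pick cols ws vs → Fin e → Fin m
  index (ctr c p)  i       = suc (index p i)
  index (keep c p) zero    = zero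
  index (keep c p) (suc i) = suc (index p i)
  index (skip c p) i       = suc (index p i)

  index-injective : ∀ (p : Pick cols ws vs) {i j} → index p i ≡ index p j → i ≡ j
  index-injective (ctr c p)  eq = index-injective p (Finₚ.suc-injective eq)
  index-injective (keep c p) {zero}  {zero}  eq = refl
  index-injective (keep c p) {suc i} {suc j} eq = cong suc (index-injective p (Finₚ.suc-injective eq))
  index-injective (skip c p) eq = index-injective p (Finₚ.suc-injective eq)

  sumCols-embed : ∀ (p : Pick cols ws vs) S T → sumCols cols (embed p S T) ≡ sumCols vs S ⊕ sumCols ws T
  sumCols-embed []         []      []      = sym (⊕-identityˡ _)
  sumCols-embed {cols = _ ∷ cols} {ws = c ∷ ws} {vs = vs} (ctr c p) S (t ∷ T) = begin
    t·c ⊕ sumCols cols (embed p S T)         ≡⟨ cong (t·c ⊕_) (sumCols-embed p S T) ⟩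
    t·c ⊕ (sumCols vs S ⊕ sumCols ws T)      ≡⟨ ⊕-assoc t·c _ _ ⟨
    (t·c ⊕ sumCols vs S) ⊕ sumCols ws T      ≡⟨ cong (_⊕ sumCols ws T) (⊕-comm t·c _) ⟩
    (sumCols vs S ⊕ t·c) ⊕ sumCols ws T      ≡⟨ ⊕-assoc _ t·c _ ⟩
    sumCols vs S ⊕ (t·c ⊕ sumCols ws T)      ∎
    where open ≡-Reasoning
          t·c = if t then c else zeroVec
  sumCols-embed (keep c p) (s ∷ S) T = trans (cong (_ ⊕_) (sumCols-embed p S T)) (sym (⊕-assoc _ _ _))
  sumCols-embed (skip c p) S       T = trans (⊕-identityˡ _) (sumCols-embed p S T)

  embed-⊥ : (p : Pick cols ws vs) → embed p ⊥ ⊥ ≡ ⊥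
  embed-⊥ []         = refl
  embed-⊥ (ctr c p)  = cong (false ∷_) (embed-⊥ p)
  embed-⊥ (keep c p) = cong (false ∷_) (embed-⊥ p)
  embed-⊥ (skip c p) = cong (false ∷_) (embed-⊥ p)

  embed-injective : ∀ (p : Pick cols ws vs) {S S′ T T′} → embed p S T ≡ embed p S′ T′ → S ≡ S′ × T ≡ T′
  embed-injective []         {[]} {[]} {[]} {[]} eq = refl , refl
  embed-injective (ctr c p)  {T = _ ∷ _} {_ ∷ _} eq with embed-injective p (∷-injectiveʳ eq)
  ... | S≡ , T≡ = S≡ , cong₂ _∷_ (∷-injectiveˡ eq) T≡
  embed-injective (keep c p) {_ ∷ _} {_ ∷ _} eq with embed-injective p (∷-injectiveʳ eq)
  ... | S≡ , T≡ = cong₂ _∷_ (∷-injectiveˡ eq) S≡ , T≡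
  embed-injective (skip c p) eq = embed-injective p (∷-injectiveʳ eq)

  image-suc : ∀ {e m} (f : Fin e → Fin m) S → image (suc ∘ f) S ≡ false ∷ image f S
  image-suc {zero}  f []          = refl
  image-suc {suc e} f (true  ∷ S) = cong (_ ∪_) (image-suc (f ∘ suc) S)
  image-suc {suc e} f (false ∷ S) = cong (_ ∪_) (image-suc (f ∘ suc) S)

  ∪-⊥ : ∀ {m} (S : Subset m) → ⊥ ∪ S ≡ S
  ∪-⊥ = zipWith-identityˡ Boolₚ.∨-identityˡ

  image-index : ∀ (p : Pick cols ws vs) S → image (index p) S ≡ embed p S ⊥
  image-index []         []          = refl
  image-index (ctr c p)  S           = trans (image-suc (index p) S) (cong (false ∷_) (image-index p S))
  image-index (keep c p) (true  ∷ S) =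
    trans (cong (⁅ zero ⁆ ∪_) (image-suc (index p) S)) (cong (true ∷_) (trans (∪-⊥ _) (image-index p S)))
  image-index (keep c p) (false ∷ S) =
    trans (cong (⊥ ∪_) (image-suc (index p) S)) (cong (false ∷_) (trans (∪-⊥ _) (image-index p S)))
  image-index (skip c p) S           = trans (image-suc (index p) S) (cong (false ∷_) (image-index p S))

  embed-∪ : ∀ (p : Pick cols ws vs) S → embed p S ⊥ ∪ embed p ⊥ ⊤ ≡ embed p S ⊤
  embed-∪ []         S       = refl
  embed-∪ (ctr c p)  S       = cong (true ∷_) (embed-∪ p S)
  embed-∪ (keep c p) (s ∷ S) = cong₂ _∷_ (Boolₚ.∨-identityʳ s) (embed-∪ p S)
  embed-∪ (skip c p) S       = cong (false ∷_) (embed-∪ p S)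

  ground-minor : (p : Pick cols ws vs) → (⊤ ─ embed p ⊥ ⊤) ─ skipped p ≡ embed p ⊤ ⊥
  ground-minor []         = refl
  ground-minor (ctr c p)  = cong (false ∷_) (ground-minor p)
  ground-minor (keep c p) = cong (true ∷_) (ground-minor p)
  ground-minor (skip c p) = cong (false ∷_) (ground-minor p)

  skipped-⊆ : (p : Pick cols ws vs) → skipped p ⊆ ⊤ ─ embed p ⊥ ⊤
  skipped-⊆ (ctr c p)  (there x∈) = there (skipped-⊆ p x∈)
  skipped-⊆ (keep c p) (there x∈) = there (skipped-⊆ p x∈)
  skipped-⊆ (skip c p) here       = here
  skipped-⊆ (skip c p) (there x∈) = there (skipped-⊆ p x∈)

  index-∈ : ∀ (p : Pick cols ws vs) i → index p i ∈ embed p ⊤ ⊥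
  index-∈ (ctr c p)  i       = there (index-∈ p i)
  index-∈ (keep c p) zero    = here
  index-∈ (keep c p) (suc i) = there (index-∈ p i)
  index-∈ (skip c p) i       = there (index-∈ p i)

  index-surjective : ∀ (p : Pick cols ws vs) {y} → y ∈ embed p ⊤ ⊥ → ∃ λ x → index p x ≡ y
  index-surjective (ctr c p)  (there y∈) with index-surjective p y∈
  ... | x , eq = x , cong suc eq
  index-surjective (keep c p) here       = zero , refl
  index-surjective (keep c p) (there y∈) with index-surjective p y∈
  ... | x , eq = suc x , cong suc eq
  index-surjective (skip c p) (there y∈) with index-surjective p y∈
  ... | x , eq = x , cong suc eq

  embed-mono : ∀ (p : Pick cols ws vs) {S S′} T T′ → S ⊆ S′ → T ⊆ T′ → embed p S T ⊆ embed p S′ T′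
  embed-mono (ctr c p)  (t ∷ T) (t′ ∷ T′) S⊆ T⊆ here with T⊆ here
  ... | here = here
  embed-mono (ctr c p)  (t ∷ T) (t′ ∷ T′) S⊆ T⊆ (there x∈) = there (embed-mono p T T′ S⊆ (drop-∷-⊆ T⊆) x∈)
  embed-mono (keep c p) {s ∷ S} {s′ ∷ S′} T T′ S⊆ T⊆ here with S⊆ here
  ... | here = here
  embed-mono (keep c p) {s ∷ S} {s′ ∷ S′} T T′ S⊆ T⊆ (there x∈) = there (embed-mono p T T′ (drop-∷-⊆ S⊆) T⊆ x∈)
  embed-mono (skip c p) T T′ S⊆ T⊆ (there x∈) = there (embed-mono p T T′ S⊆ T⊆ x∈)

  ⊆-embed : ∀ (p : Pick cols ws vs) S U → U ⊆ embed p S ⊤ → ∃ λ S′ → ∃ λ T → S′ ⊆ S × U ≡ embed p S′ T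
  ⊆-embed []         []      []      U⊆ = [] , [] , id , refl
  ⊆-embed (ctr c p)  S       (u ∷ U) U⊆ with ⊆-embed p S U (drop-∷-⊆ U⊆)
  ... | S′ , T , S′⊆ , eq = S′ , u ∷ T , S′⊆ , cong (u ∷_) eq
  ⊆-embed (keep c p) (s ∷ S) (u ∷ U) U⊆ with ⊆-embed p S U (drop-∷-⊆ U⊆)
  ... | S′ , T , S′⊆ , eq = u ∷ S′ , T , sub , cong (u ∷_) eq
    where sub : u ∷ S′ ⊆ s ∷ S
          sub here with U⊆ here
          ... | here = here
          sub (there x∈) = there (S′⊆ x∈)
  ⊆-embed (skip c p) S (true  ∷ U) U⊆ with U⊆ here
  ... | ()
  ⊆-embed (skip c p) S (false ∷ U) U⊆ with ⊆-embed p S U (drop-∷-⊆ U⊆)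
  ... | S′ , T , S′⊆ , eq = S′ , T , S′⊆ , cong (false ∷_) eq

  -- Contract ws and delete the skipped columns. A linear map killing ws and sending
  -- vs to B shows that the remaining columns satisfy no more relations than B does.
  pick⇒minor : ∀ {n m l e r} (B : Vec (GF2Vec r) e)
               {cols : Vec (GF2Vec n) m} {ws : Vec (GF2Vec n) l} {vs : Vec (GF2Vec n) e} →
               Pick cols ws vs → Indep ws →
               (labels : Vec (GF2Vec r) n) →
               (∀ T → sumCols labels (sumCols ws T) ≡ zeroVec) →
               (∀ S → sumCols labels (sumCols vs S) ≡ sumCols B S) →
               (∀ S → sumCols B S ≡ zeroVec → Span ws (sumCols vs S)) →
               IsMinorOf (columnMatroid B) (columnMatroid cols)
  pick⇒minor B {cols} {ws} {vs} p ind labels ws↦0 vs↦B rel =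
    -- Contracting first makes the validity condition the independence of `ws` in the full column
    -- matroid.
    con X ∷ del (skipped p) ∷ [] ,
    (((λ _ → ∈⊤) , X-indep) , skipped-⊆ p , tt) ,
    index p , index-injective p ,
    (λ x → subst (index p x ∈_) (sym (ground-minor p)) (index-∈ p x)) ,
    (λ y y∈ → index-surjective p (subst (y ∈_) (ground-minor p) y∈)) ,
    λ S _ → to S , from S
    where
    X = embed p ⊥ ⊤

    -- `labels` kills the contracted part of a vanishing combination, which leaves a relation of
    -- `B`.
    relation : ∀ S T → sumCols cols (embed p S T) ≡ zeroVec → sumCols B S ≡ zeroVec
    relation S T eq = begin
      sumCols B S                    ≡⟨ vs↦B S ⟨
      sumCols labels (sumCols vs S)  ≡⟨ cong (sumCols labels) (⊕≡0⇒≡ _ _ (trans (sym (sumCols-embed p S T)) eq)) ⟩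
      sumCols labels (sumCols ws T)  ≡⟨ ws↦0 T ⟩
      zeroVec                        ∎
      where open ≡-Reasoning

    indep-embed : ∀ S → LinIndep B S → LinIndep cols (embed p S ⊤)
    indep-embed S indB U U⊆ U≢∅ eq with ⊆-embed p S U U⊆
    -- Either a kept column occurs, and `relation` contradicts the independence of `S` in `B`, or
    -- the relation is among `ws` alone.
    ... | S′ , T , S′⊆ , refl with S′ ≟ᵛ ⊥
    ...   | no S′≢⊥ = indB S′ S′⊆ (≢⊥⇒nonempty S′ S′≢⊥) (relation S′ T eq)
    ...   | yes refl with indep⇒0 ws ind T
                            (trans (sym (trans (cong (_⊕ sumCols ws T) (sumCols-0 vs)) (⊕-identityˡ _)))
                                   (trans (sym (sumCols-embed p ⊥ T)) eq))
    ...     | refl = nonempty⇒≢⊥ U≢∅ (embed-⊥ p)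

    X-indep : LinIndep cols X
    X-indep = indep-embed ⊥ (λ T T⊆ (x , x∈) → contradiction (T⊆ x∈) ∉⊥)

    ⊆ground : ∀ S → image (index p) S ⊆ (⊤ ─ X) ─ skipped p
    ⊆ground S x∈ = subst (_ ∈_) (sym (ground-minor p))
      (embed-mono p ⊥ ⊥ (λ _ → ∈⊤) id (subst (_ ∈_) (image-index p S) x∈))

    image∪X : ∀ S → image (index p) S ∪ X ≡ embed p S ⊤
    image∪X S = trans (cong (_∪ X) (image-index p S)) (embed-∪ p S)

    to : ∀ S → LinIndep B S → (image (index p) S ⊆ ⊤ ─ X × LinIndep cols (image (index p) S ∪ X))
                              × image (index p) S ⊆ (⊤ ─ X) ─ skipped p
    to S indB = (p─q⊆p (⊤ ─ X) (skipped p) ∘ ⊆ground S ,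
                 subst (LinIndep cols) (sym (image∪X S)) (indep-embed S indB)) ,
                ⊆ground S

    from : ∀ S → (image (index p) S ⊆ ⊤ ─ X × LinIndep cols (image (index p) S ∪ X))
                 × image (index p) S ⊆ (⊤ ─ X) ─ skipped p → LinIndep B S
    -- A relation of `B` on `S′` is completed by contracted columns `T` to a vanishing combination
    -- of `cols`.
    from S ((_ , indC) , _) S′ S′⊆ S′≢∅ eq with rel S′ eq
    ... | T , sumT = subst (LinIndep cols) (image∪X S) indC (embed p S′ T)
          (embed-mono p T ⊤ S′⊆ (λ _ → ∈⊤))
          (≢⊥⇒nonempty _ λ U≡⊥ → nonempty⇒≢⊥ S′≢∅
            (proj₁ (embed-injective p (trans U≡⊥ (sym (embed-⊥ p))))))
          (trans (sumCols-embed p S′ T) (trans (cong (sumCols vs S′ ⊕_) sumT) (⊕-self _)))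

-- Sums and counts over finite lists.

sumOver : ∀ {A : Set} → (A → ℕ) → List A → ℕ
sumOver f xs = sum (map f xs)

sumOver-mono : ∀ {A : Set} {f g : A → ℕ} xs → (∀ x → x ∈ₗ xs → f x ≤ g x) → sumOver f xs ≤ sumOver g xs
sumOver-mono []       f≤g = z≤n
sumOver-mono (x ∷ xs) f≤g = ℕₚ.+-mono-≤ (f≤g x (here refl)) (sumOver-mono xs λ y y∈ → f≤g y (there y∈))

sumOver-cong : ∀ {A : Set} {f g : A → ℕ} xs → (∀ x → f x ≡ g x) → sumOver f xs ≡ sumOver g xs
sumOver-cong []       f≡g = refl
sumOver-cong (x ∷ xs) f≡g = cong₂ _+_ (f≡g x) (sumOver-cong xs f≡g)

sumOver-+ : ∀ {A : Set} (f g : A → ℕ) xs → sumOver (λ x → f x + g x) xs ≡ sumOver f xs + sumOver g xs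
sumOver-+ f g []       = refl
sumOver-+ f g (x ∷ xs) = trans (cong (f x + g x +_) (sumOver-+ f g xs)) (interchange (f x) (g x) _ _)
  where interchange : ∀ a b c d → a + b + (c + d) ≡ a + c + (b + d)
        interchange = solve-∀

sumOver-* : ∀ {A : Set} (f : A → ℕ) c xs → sumOver (λ x → c * f x) xs ≡ c * sumOver f xs
sumOver-* f c []       = sym (ℕₚ.*-zeroʳ c)
sumOver-* f c (x ∷ xs) = trans (cong (c * f x +_) (sumOver-* f c xs)) (sym (ℕₚ.*-distribˡ-+ c (f x) _))

sumOver-const : ∀ {A : Set} c (xs : List A) → sumOver (λ _ → c) xs ≡ length xs * c
sumOver-const c []       = refl
sumOver-const c (x ∷ xs) = cong (c +_) (sumOver-const c xs)

sumOver-++ : ∀ {A : Set} (f : A → ℕ) xs ys → sumOver f (xs ++ₗ ys) ≡ sumOver f xs + sumOver f ys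
sumOver-++ f []       ys = refl
sumOver-++ f (x ∷ xs) ys = trans (cong (f x +_) (sumOver-++ f xs ys)) (sym (ℕₚ.+-assoc (f x) _ _))

sumOver-map : ∀ {A B : Set} (f : B → ℕ) (g : A → B) xs → sumOver f (map g xs) ≡ sumOver (f ∘ g) xs
sumOver-map f g []       = refl
sumOver-map f g (x ∷ xs) = cong (f (g x) +_) (sumOver-map f g xs)

sumOver-product : ∀ {A B C : Set} (f : C → ℕ) (g : A → B → C) xs ys →
  sumOver f (cartesianProductWith g xs ys) ≡ sumOver (λ x → sumOver (λ y → f (g x y)) ys) xs
sumOver-product f g []       ys = refl
sumOver-product f g (x ∷ xs) ys =
  trans (sumOver-++ f (map (g x) ys) _) (cong₂ _+_ (sumOver-map f (g x) ys) (sumOver-product f g xs ys))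

sumOver-swap : ∀ {A B : Set} (f : A → B → ℕ) xs ys →
  sumOver (λ x → sumOver (f x) ys) xs ≡ sumOver (λ y → sumOver (λ x → f x y) xs) ys
sumOver-swap f []       ys = sym (trans (sumOver-const 0 ys) (ℕₚ.*-zeroʳ (length ys)))
sumOver-swap f (x ∷ xs) ys =
  trans (cong (sumOver (f x) ys +_) (sumOver-swap f xs ys)) (sym (sumOver-+ (f x) _ ys))

𝟙 : {P : Set} → Dec P → ℕ
𝟙 P? = if does P? then 1 else 0

𝟙-mono : {P Q : Set} (P? : Dec P) (Q? : Dec Q) → (P → Q) → 𝟙 P? ≤ 𝟙 Q?
𝟙-mono (no _)  Q?      P⇒Q = z≤n
𝟙-mono (yes p) (yes _) P⇒Q = s≤s z≤n
𝟙-mono (yes p) (no ¬q) P⇒Q = contradiction (P⇒Q p) ¬q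

𝟙≤ : {P : Set} (P? : Dec P) {k : ℕ} → (P → 1 ≤ k) → 𝟙 P? ≤ k
𝟙≤ (no _)  P⇒ = z≤n
𝟙≤ (yes p) P⇒ = P⇒ p

𝟙-no : {P : Set} (P? : Dec P) → ¬ P → 𝟙 P? ≡ 0
𝟙-no (no _)  ¬p = refl
𝟙-no (yes p) ¬p = contradiction p ¬p

𝟙-¬ : {P : Set} (P? : Dec P) → 𝟙 P? + 𝟙 (¬? P?) ≡ 1
𝟙-¬ (no _)  = refl
𝟙-¬ (yes _) = refl

count : ∀ {A : Set} {P : A → Set} → Decidable P → List A → ℕ
count P? = sumOver (𝟙 ∘ P?)

count-mono : ∀ {A : Set} {P Q : A → Set} (P? : Decidable P) (Q? : Decidable Q) xs →
             (∀ x → P x → Q x) → count P? xs ≤ count Q? xs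
count-mono P? Q? xs P⇒Q = sumOver-mono xs (λ x _ → 𝟙-mono (P? x) (Q? x) (P⇒Q x))

count-¬ : ∀ {A : Set} {P : A → Set} (P? : Decidable P) xs → count P? xs + count (¬? ∘ P?) xs ≡ length xs
count-¬ P? xs = begin
  count P? xs + count (¬? ∘ P?) xs         ≡⟨ sumOver-+ _ _ xs ⟨
  sumOver (λ x → 𝟙 (P? x) + 𝟙 (¬? (P? x))) xs ≡⟨ sumOver-cong xs (𝟙-¬ ∘ P?) ⟩
  sumOver (λ _ → 1) xs                     ≡⟨ sumOver-const 1 xs ⟩
  length xs * 1                            ≡⟨ ℕₚ.*-identityʳ _ ⟩
  length xs                                ∎
  where open ≡-Reasoning

length-filter≡count : ∀ {A : Set} {P : A → Set} (P? : Decidable P) xs → length (filter P? xs) ≡ count P? xs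
length-filter≡count P? []       = refl
length-filter≡count P? (x ∷ xs) with P? x
... | yes _ = cong suc (length-filter≡count P? xs)
... | no _  = length-filter≡count P? xs

lookup-injective : ∀ {A : Set} {xs : List A} → Unique xs → ∀ {i j} → lookupₗ xs i ≡ lookupₗ xs j → i ≡ j
lookup-injective (x∉ ∷ u) {zero}  {zero}  eq = refl
lookup-injective (x∉ ∷ u) {zero}  {suc j} eq = contradiction eq (ListAll.lookup x∉ (∈ₚ.∈-lookup j))
lookup-injective (x∉ ∷ u) {suc i} {zero}  eq = contradiction (sym eq) (ListAll.lookup x∉ (∈ₚ.∈-lookup i))
lookup-injective (x∉ ∷ u) {suc i} {suc j} eq = cong suc (lookup-injective u eq)

-- Pigeonhole: a position in `ys` determines the entry, and the entry determines its position in
-- `xs`.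
unique⇒length≤ : ∀ {A : Set} {xs ys : List A} → Unique xs → (∀ {x} → x ∈ₗ xs → x ∈ₗ ys) → length xs ≤ length ys
unique⇒length≤ {xs = xs} {ys} u xs⊆ys = Finₚ.injective⇒≤ {f = f} f-injective
  where
  mem : ∀ i → lookupₗ xs i ∈ₗ ys
  mem i = xs⊆ys (∈ₚ.∈-lookup i)
  f : Fin (length xs) → Fin (length ys)
  f i = Any-index (mem i)
  f-injective : ∀ {i j} → f i ≡ f j → i ≡ j
  f-injective {i} {j} eq = lookup-injective u
    (trans (lookup-index (mem i)) (trans (cong (lookupₗ ys) eq) (sym (lookup-index (mem j)))))

-- Density bounds come from this: a duplicate-free list of favourable outcomes bounds their number
-- from below.
unique⇒length≤count : ∀ {A : Set} {P : A → Set} (P? : Decidable P) {xs ys : List A} → Unique xs →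
                      (∀ {x} → x ∈ₗ xs → x ∈ₗ ys × P x) → length xs ≤ count P? ys
unique⇒length≤count P? {ys = ys} u sub = subst (_ ≤_) (length-filter≡count P? ys)
  (unique⇒length≤ u (λ x∈ → ∈ₚ.∈-filter⁺ P? (proj₁ (sub x∈)) (proj₂ (sub x∈))))

length-product : ∀ {A B C : Set} (g : A → B → C) xs ys →
                 length (cartesianProductWith g xs ys) ≡ length xs * length ys
length-product g []       ys = refl
length-product g (x ∷ xs) ys =
  trans (length-++ (map (g x) ys)) (cong₂ _+_ (length-map (g x) ys) (length-product g xs ys))

-- The sample space: k-subsets and sequences of columns.

subsetsOfSize : (n k : ℕ) → List (Subset n)
subsetsOfSize zero    zero    = [] ∷ []
subsetsOfSize zero    (suc k) = []
subsetsOfSize (suc n) zero    = map (false ∷_) (subsetsOfSize n zero)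
subsetsOfSize (suc n) (suc k) =
  map (true ∷_) (subsetsOfSize n k) ++ₗ map (false ∷_) (subsetsOfSize n (suc k))

length-subsetsOfSize : ∀ n k → length (subsetsOfSize n k) ≡ n C k
length-subsetsOfSize zero    zero    = refl
length-subsetsOfSize zero    (suc k) = refl
length-subsetsOfSize (suc n) zero    = trans (length-map _ (subsetsOfSize n 0)) (length-subsetsOfSize n zero)
length-subsetsOfSize (suc n) (suc k) = begin
  length (map (true ∷_) (subsetsOfSize n k) ++ₗ map (false ∷_) (subsetsOfSize n (suc k)))
    ≡⟨ length-++ (map (true ∷_) (subsetsOfSize n k)) ⟩
  length (map (true ∷_) (subsetsOfSize n k)) + length (map (false ∷_) (subsetsOfSize n (suc k)))
    ≡⟨ cong₂ _+_ (length-map _ (subsetsOfSize n k)) (length-map _ (subsetsOfSize n (suc k))) ⟩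
  length (subsetsOfSize n k) + length (subsetsOfSize n (suc k))
    ≡⟨ cong₂ _+_ (length-subsetsOfSize n k) (length-subsetsOfSize n (suc k)) ⟩
  n C k + n C suc k
    ≡⟨ nCk+nC[k+1]≡[n+1]C[k+1] n k ⟩
  suc n C suc k ∎
  where open ≡-Reasoning

subsetsOfSize-unique : ∀ n k → Unique (subsetsOfSize n k)
subsetsOfSize-unique zero    zero    = [] ∷ []
subsetsOfSize-unique zero    (suc k) = []
subsetsOfSize-unique (suc n) zero    = Uniqueₚ.map⁺ ∷-injectiveʳ (subsetsOfSize-unique n zero)
subsetsOfSize-unique (suc n) (suc k) = Uniqueₚ.++⁺
  (Uniqueₚ.map⁺ ∷-injectiveʳ (subsetsOfSize-unique n k))
  (Uniqueₚ.map⁺ ∷-injectiveʳ (subsetsOfSize-unique n (suc k)))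
  λ (x∈ , x∈′) → true≢false (trans (sym (proj₂ (proj₂ (∈ₚ.∈-map⁻ _ x∈)))) (proj₂ (proj₂ (∈ₚ.∈-map⁻ _ x∈′))))
  where true≢false : ∀ {n} {u v : Subset n} → true ∷ u ≢ false ∷ v
        true≢false ()

subsetsOfSize⁺ : ∀ {n} (s : Subset n) → s ∈ₗ subsetsOfSize n ∣ s ∣
subsetsOfSize⁺ []          = here refl
subsetsOfSize⁺ (true  ∷ s) = ∈ₚ.∈-++⁺ˡ (∈ₚ.∈-map⁺ _ (subsetsOfSize⁺ s))
subsetsOfSize⁺ (false ∷ s) with ∣ s ∣ | subsetsOfSize⁺ s
... | zero  | s∈ = ∈ₚ.∈-map⁺ _ s∈
... | suc k | s∈ = ∈ₚ.∈-++⁺ʳ _ (∈ₚ.∈-map⁺ _ s∈)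

subsetsOfSize⁻ : ∀ n k {s : Subset n} → s ∈ₗ subsetsOfSize n k → ∣ s ∣ ≡ k
subsetsOfSize⁻ zero    zero    {[]} _ = refl
subsetsOfSize⁻ (suc n) zero    s∈ with ∈ₚ.∈-map⁻ _ s∈
... | s′ , s′∈ , refl = subsetsOfSize⁻ n zero s′∈
subsetsOfSize⁻ (suc n) (suc k) s∈ with ∈ₚ.∈-++⁻ (map (true ∷_) (subsetsOfSize n k)) s∈
... | inj₁ s∈₁ with ∈ₚ.∈-map⁻ _ s∈₁
...   | s′ , s′∈ , refl = cong suc (subsetsOfSize⁻ n k s′∈)
subsetsOfSize⁻ (suc n) (suc k) s∈ | inj₂ s∈₂ with ∈ₚ.∈-map⁻ _ s∈₂
...   | s′ , s′∈ , refl = subsetsOfSize⁻ n (suc k) s′∈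

seqs : ∀ {A : Set} → List A → (t : ℕ) → List (Vec A t)
seqs xs zero    = [] ∷ []
seqs xs (suc t) = cartesianProductWith _∷_ xs (seqs xs t)

length-seqs : ∀ {A : Set} (xs : List A) t → length (seqs xs t) ≡ length xs ^ t
length-seqs xs zero    = refl
length-seqs xs (suc t) = trans (length-product _∷_ xs (seqs xs t)) (cong (length xs *_) (length-seqs xs t))

seqs-unique : ∀ {A : Set} {xs : List A} → Unique xs → ∀ t → Unique (seqs xs t)
seqs-unique u zero    = [] ∷ []
seqs-unique u (suc t) = Uniqueₚ.cartesianProductWith⁺ _∷_ ∷-injective u (seqs-unique u t)

seqs⁻ : ∀ {A : Set} (xs : List A) t {v : Vec A t} → v ∈ₗ seqs xs t → VecAll.All (_∈ₗ xs) v
seqs⁻ xs zero    {[]} _  = VecAll.[]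
seqs⁻ xs (suc t) v∈ with ∈ₚ.∈-cartesianProductWith⁻ _∷_ xs (seqs xs t) v∈
... | x , v′ , x∈ , v′∈ , refl = x∈ VecAll.∷ seqs⁻ xs t v′∈

-- Distinct coefficient vectors give distinct combinations, so 2^l of them fit among the 2^n
-- vectors.
rank≤ : ∀ {n l} (ws : Vec (GF2Vec n) l) → Indep ws → l ≤ n
rank≤ {n} {l} ws ind = ℕₚ.≮⇒≥ λ n<l → ℕₚ.<⇒≱ (ℕₚ.^-monoʳ-< 2 (s≤s (s≤s z≤n)) n<l) 2^l≤2^n
  where
  bools : List Bool
  bools = true ∷ false ∷ []
  all-∈ : ∀ {t} (v : Vec Bool t) → v ∈ₗ seqs bools t
  all-∈ []          = here refl
  all-∈ (true  ∷ v) = ∈ₚ.∈-cartesianProductWith⁺ _∷_ {xs = bools} {ys = seqs bools _} (here refl) (all-∈ v)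
  all-∈ (false ∷ v) = ∈ₚ.∈-cartesianProductWith⁺ _∷_ {xs = bools} {ys = seqs bools _} (there (here refl)) (all-∈ v)
  2^l≤2^n : 2 ^ l ≤ 2 ^ n
  2^l≤2^n = subst₂ _≤_
    (trans (length-map (sumCols ws) (seqs bools l)) (length-seqs bools l)) (length-seqs bools n)
    (unique⇒length≤
      (Uniqueₚ.map⁺ (sumCols-injective ws ind) (seqs-unique (((λ ()) ∷ []) ∷ [] ∷ []) l))
      (λ {x} _ → all-∈ x))

-- Exponential decay along independent draws.

-- If f never exceeds W and is at most W / 2 on a 1/D fraction of the list, its
-- average is at most (1 - 1/(2D)) W; here 2D = suc K.
average-decrease : ∀ {A : Set} {P : A → Set} (P? : Decidable P) (f : A → ℕ) (xs : List A) D K W →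
  suc K ≡ 2 * D → (∀ x → f x ≤ W) → (∀ x → P x → 2 * f x ≤ W) →
  length xs ≤ D * count P? xs →
  suc K * sumOver f xs ≤ K * (length xs * W)
average-decrease P? f xs D K W 2D f≤ 2f≤ dense = ℕₚ.+-cancelʳ-≤ (length xs * W) _ _ (begin
  suc K * S + N * W          ≤⟨ ℕₚ.+-monoʳ-≤ (suc K * S) (ℕₚ.*-monoˡ-≤ W dense) ⟩
  suc K * S + D * c * W      ≡⟨ cong (λ k → k * S + D * c * W) 2D ⟩
  2 * D * S + D * c * W      ≡⟨ e₁ D S c W ⟩
  D * (2 * S + c * W)        ≤⟨ ℕₚ.*-monoʳ-≤ D total ⟩
  D * (N * (2 * W))          ≡⟨ e₂ D N W ⟩
  2 * D * (N * W)            ≡⟨ cong (_* (N * W)) 2D ⟨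
  suc K * (N * W)            ≡⟨ ℕₚ.+-comm (N * W) _ ⟩
  K * (N * W) + N * W        ∎)
  where
  open ℕₚ.≤-Reasoning
  S = sumOver f xs
  N = length xs
  c = count P? xs
  e₁ : ∀ D S c W → 2 * D * S + D * c * W ≡ D * (2 * S + c * W)
  e₁ = solve-∀
  e₂ : ∀ D N W → D * (N * (2 * W)) ≡ 2 * D * (N * W)
  e₂ = solve-∀
  -- Where `P` holds, halving leaves room for one more `W`; this form covers both cases, so it can
  -- be summed.
  pointwise : ∀ x → 2 * f x + W * 𝟙 (P? x) ≤ 2 * W
  pointwise x with P? x
  ... | yes p = begin
    2 * f x + W * 1 ≡⟨ cong (2 * f x +_) (ℕₚ.*-identityʳ W) ⟩
    2 * f x + W     ≤⟨ ℕₚ.+-monoˡ-≤ W (2f≤ x p) ⟩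
    W + W           ≡⟨ cong (W +_) (ℕₚ.+-identityʳ W) ⟨
    2 * W           ∎
  ... | no _  = begin
    2 * f x + W * 0 ≡⟨ cong (2 * f x +_) (ℕₚ.*-zeroʳ W) ⟩
    2 * f x + 0     ≡⟨ ℕₚ.+-identityʳ _ ⟩
    2 * f x         ≤⟨ ℕₚ.*-monoʳ-≤ 2 (f≤ x) ⟩
    2 * W           ∎
  total : 2 * S + c * W ≤ N * (2 * W)
  total = begin
    2 * S + c * W  ≡⟨ cong₂ _+_ (sumOver-* f 2 xs) (trans (sumOver-* (𝟙 ∘ P?) W xs) (ℕₚ.*-comm W c)) ⟨
    sumOver (λ x → 2 * f x) xs + sumOver (λ x → W * 𝟙 (P? x)) xs ≡⟨ sumOver-+ _ _ xs ⟨
    sumOver (λ x → 2 * f x + W * 𝟙 (P? x)) xs ≤⟨ sumOver-mono xs (λ x _ → pointwise x) ⟩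
    sumOver (λ _ → 2 * W) xs ≡⟨ sumOver-const (2 * W) xs ⟩
    N * (2 * W)  ∎

-- A new draw goes to the front; by hypothesis it multiplies the conditional mean of `F` by at most
-- K/(K + 1), and this is iterated.
supermartingale : ∀ {A : Set} (xs : List A) (F : ∀ {t} → Vec A t → ℕ) K →
  (∀ {t} (v : Vec A t) → suc K * sumOver (λ x → F (x ∷ v)) xs ≤ K * (length xs * F v)) →
  ∀ t → suc K ^ t * sumOver F (seqs xs t) ≤ K ^ t * (length xs ^ t * F [])
supermartingale xs F K step zero    = ℕₚ.≤-reflexive (e (F []))
  where e : ∀ x → 1 * (x + 0) ≡ 1 * (1 * x)
        e = solve-∀
supermartingale xs F K step (suc t) = begin
  suc K * suc K ^ t * sumOver F (seqs xs (suc t))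
    ≡⟨ cong (suc K * suc K ^ t *_) (trans (sumOver-product F _∷_ xs (seqs xs t)) (sumOver-swap _ xs (seqs xs t))) ⟩
  suc K * suc K ^ t * sumOver (λ v → sumOver (λ x → F (x ∷ v)) xs) (seqs xs t)
    ≡⟨ e₁ (suc K) (suc K ^ t) _ ⟩
  suc K ^ t * (suc K * sumOver (λ v → sumOver (λ x → F (x ∷ v)) xs) (seqs xs t))
    ≡⟨ cong (suc K ^ t *_) (sumOver-* _ (suc K) (seqs xs t)) ⟨
  suc K ^ t * sumOver (λ v → suc K * sumOver (λ x → F (x ∷ v)) xs) (seqs xs t)
    ≤⟨ ℕₚ.*-monoʳ-≤ (suc K ^ t) (sumOver-mono (seqs xs t) (λ v _ → step v)) ⟩
  suc K ^ t * sumOver (λ v → K * (N * F v)) (seqs xs t)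
    ≡⟨ cong (suc K ^ t *_) (trans (sumOver-* _ K (seqs xs t)) (cong (K *_) (sumOver-* F N (seqs xs t)))) ⟩
  suc K ^ t * (K * (N * sumOver F (seqs xs t)))
    ≡⟨ e₂ (suc K ^ t) K N _ ⟩
  K * N * (suc K ^ t * sumOver F (seqs xs t))
    ≤⟨ ℕₚ.*-monoʳ-≤ (K * N) (supermartingale xs F K step t) ⟩
  K * N * (K ^ t * (N ^ t * F []))
    ≡⟨ e₃ K N (K ^ t) (N ^ t) (F []) ⟩
  K * K ^ t * (N * N ^ t * F []) ∎
  where
  open ℕₚ.≤-Reasoning
  N = length xs
  e₁ : ∀ a b c → a * b * c ≡ b * (a * c)
  e₁ = solve-∀
  e₂ : ∀ a b c d → a * (b * (c * d)) ≡ b * c * (a * d)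
  e₂ = solve-∀
  e₃ : ∀ a b c d x → a * b * (c * (d * x)) ≡ a * c * (b * d * x)
  e₃ = solve-∀

module _ {A B : Set} {P : B → A → Set} where

  -- Targets are met in order at increasing positions, so repeated targets still get different
  -- columns, and the kept columns come out in the order of the list.
  Hits : ∀ {t} → List B → Vec A t → Set
  Hits []       v       = Unit
  Hits (b ∷ bs) []      = Empty
  Hits (b ∷ bs) (x ∷ v) = (P b x × Hits bs v) ⊎ Hits (b ∷ bs) v

  hits? : (∀ b x → Dec (P b x)) → ∀ {t} bs (v : Vec A t) → Dec (Hits bs v)
  hits? P? []       v       = yes tt
  hits? P? (b ∷ bs) []      = no λ ()
  hits? P? (b ∷ bs) (x ∷ v) = (P? b x ×-dec hits? P? bs v) ⊎-dec hits? P? (b ∷ bs) v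

  -- If the next draw serves the first target, the remaining list has a bound half as large, so
  -- `average-decrease` applies. The power of 2 acts as a potential.
  few-misses : (P? : ∀ b x → Dec (P b x)) (xs : List A) (D K : ℕ) → suc K ≡ 2 * D →
               (∀ b → length xs ≤ D * count (P? b) xs) → ∀ t bs →
               suc K ^ t * count (λ v → ¬? (hits? P? bs v)) (seqs xs t) ≤ K ^ t * (length xs ^ t * 2 ^ length bs)
  few-misses P? xs D K 2D dense t [] = begin
    suc K ^ t * count (λ v → ¬? (yes tt)) (seqs xs t) ≡⟨ cong (suc K ^ t *_) (trans (sumOver-const 0 (seqs xs t)) (ℕₚ.*-zeroʳ (length (seqs xs t)))) ⟩
    suc K ^ t * 0                                     ≡⟨ ℕₚ.*-zeroʳ (suc K ^ t) ⟩
    0                                                 ≤⟨ z≤n ⟩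
    _                                                 ∎
    where open ℕₚ.≤-Reasoning
  few-misses P? xs D K 2D dense zero (b ∷ bs) =
    ℕₚ.≤-trans (ℕₚ.m^n>0 2 (suc (length bs))) (ℕₚ.≤-reflexive (e (2 ^ length (b ∷ bs))))
    where e : ∀ x → x ≡ 1 * (1 * x)
          e = solve-∀
  few-misses P? xs D K 2D dense (suc t) bs′@(b ∷ bs) = begin
    suc K * suc K ^ t * count (λ v → ¬? (hits? P? bs′ v)) (seqs xs (suc t))
      ≡⟨ cong (suc K * suc K ^ t *_) (sumOver-product _ _∷_ xs (seqs xs t)) ⟩
    suc K * suc K ^ t * sumOver f xs
      ≡⟨ ℕₚ.*-assoc (suc K) (suc K ^ t) _ ⟩
    suc K * (suc K ^ t * sumOver f xs)
      ≡⟨ cong (suc K *_) (sumOver-* f (suc K ^ t) xs) ⟨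
    suc K * sumOver (λ x → suc K ^ t * f x) xs
      ≤⟨ average-decrease (P? b) (λ x → suc K ^ t * f x) xs D K W 2D f≤W 2f≤W (dense b) ⟩
    K * (N * W)
      ≡⟨ e₁ K N (K ^ t) (N ^ t) (2 ^ length bs′) ⟩
    K * K ^ t * (N * N ^ t * 2 ^ length bs′) ∎
    where
    open ℕₚ.≤-Reasoning
    N = length xs
    W = K ^ t * (N ^ t * 2 ^ length bs′)
    f : A → ℕ
    f x = count (λ v → ¬? (hits? P? bs′ (x ∷ v))) (seqs xs t)
    e₁ : ∀ a b c d x → a * (b * (c * (d * x))) ≡ a * c * (b * d * x)
    e₁ = solve-∀
    e₂ : ∀ a b x → 2 * (a * (b * x)) ≡ a * (b * (2 * x))
    e₂ = solve-∀
    f≤W : ∀ x → suc K ^ t * f x ≤ W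
    f≤W x = ℕₚ.≤-trans
      (ℕₚ.*-monoʳ-≤ (suc K ^ t) (count-mono (λ v → ¬? (hits? P? bs′ (x ∷ v))) (λ v → ¬? (hits? P? bs′ v)) (seqs xs t) (λ v ¬h h → ¬h (inj₂ h))))
      (few-misses P? xs D K 2D dense t bs′)
    2f≤W : ∀ x → P b x → 2 * (suc K ^ t * f x) ≤ W
    2f≤W x p = begin
      2 * (suc K ^ t * f x)
        ≤⟨ ℕₚ.*-monoʳ-≤ 2 (ℕₚ.*-monoʳ-≤ (suc K ^ t)
             (count-mono (λ v → ¬? (hits? P? bs′ (x ∷ v))) (λ v → ¬? (hits? P? bs v)) (seqs xs t)
               (λ v ¬h h → ¬h (inj₁ (p , h))))) ⟩
      2 * (suc K ^ t * count (λ v → ¬? (hits? P? bs v)) (seqs xs t))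
        ≤⟨ ℕₚ.*-monoʳ-≤ 2 (few-misses P? xs D K 2D dense t bs) ⟩
      2 * (K ^ t * (N ^ t * 2 ^ length bs))
        ≡⟨ e₂ (K ^ t) (N ^ t) _ ⟩
      W ∎

-- Bernoulli's inequality and estimates of binomial coefficients.

bernoulli : ∀ K t → K ^ t * (K + t) ≤ suc K ^ t * K
bernoulli K zero    = ℕₚ.≤-reflexive (cong (1 *_) (ℕₚ.+-identityʳ K))
bernoulli K (suc t) = begin
  K * K ^ t * (K + suc t)        ≤⟨ ℕₚ.m≤m+n _ (K ^ t * t) ⟩
  K * K ^ t * (K + suc t) + K ^ t * t ≡⟨ e K t (K ^ t) ⟩
  suc K * (K ^ t * (K + t))      ≤⟨ ℕₚ.*-monoʳ-≤ (suc K) (bernoulli K t) ⟩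
  suc K * (suc K ^ t * K)        ≡⟨ ℕₚ.*-assoc (suc K) (suc K ^ t) K ⟨
  suc K * suc K ^ t * K          ∎
  where
  open ℕₚ.≤-Reasoning
  e : ∀ K t x → K * x * (K + suc t) + x * t ≡ suc K * (x * (K + t))
  e = solve-∀

-- The failure factor (K/(K + 1))^t has dropped to 1/c once t reaches cK.
bernoulli-large : ∀ K c t .{{_ : NonZero K}} → c * K ≤ t → c * K ^ t ≤ suc K ^ t
bernoulli-large K c t cK≤t = ℕₚ.*-cancelʳ-≤ _ _ K (begin
  c * K ^ t * K      ≡⟨ e c (K ^ t) K ⟩
  K ^ t * (c * K)    ≤⟨ ℕₚ.*-monoʳ-≤ (K ^ t) (ℕₚ.≤-trans cK≤t (ℕₚ.m≤n+m t K)) ⟩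
  K ^ t * (K + t)    ≤⟨ bernoulli K t ⟩
  suc K ^ t * K      ∎)
  where
  open ℕₚ.≤-Reasoning
  e : ∀ c x K → c * x * K ≡ x * (c * K)
  e = solve-∀

C-absorption : ∀ n k → suc k * (suc n C suc k) ≡ suc n * (n C k)
C-absorption zero    zero    = refl
C-absorption zero    (suc k) = ℕₚ.*-zeroʳ k
C-absorption (suc n) zero    = begin
  1 * (suc (suc n) C 1)  ≡⟨ ℕₚ.*-identityˡ _ ⟩
  suc (suc n) C 1        ≡⟨ nC1≡n (suc (suc n)) ⟩
  suc (suc n)            ≡⟨ ℕₚ.*-identityʳ _ ⟨
  suc (suc n) * 1        ∎
  where open ≡-Reasoning
C-absorption (suc n) (suc k) = begin
  suc (suc k) * (suc (suc n) C suc (suc k))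
    ≡⟨ cong (suc (suc k) *_) (nCk+nC[k+1]≡[n+1]C[k+1] (suc n) (suc k)) ⟨
  suc (suc k) * (x + y)
    ≡⟨ e₁ k x y ⟩
  suc k * x + suc (suc k) * y + x
    ≡⟨ cong₂ (λ u v → u + v + x) (C-absorption n k) (C-absorption n (suc k)) ⟩
  suc n * (n C k) + suc n * (n C suc k) + x
    ≡⟨ cong (_+ x) (ℕₚ.*-distribˡ-+ (suc n) (n C k) (n C suc k)) ⟨
  suc n * (n C k + n C suc k) + x
    ≡⟨ cong (λ u → suc n * u + x) (nCk+nC[k+1]≡[n+1]C[k+1] n k) ⟩
  suc n * x + x
    ≡⟨ ℕₚ.+-comm (suc n * x) x ⟩
  suc (suc n) * x ∎
  where
  open ≡-Reasoning
  x = suc n C suc k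
  y = suc n C suc (suc k)
  e₁ : ∀ k x y → suc (suc k) * (x + y) ≡ suc k * x + suc (suc k) * y + x
  e₁ = solve-∀

C-suc-≤ : ∀ n k → n C k ≤ suc n C k
C-suc-≤ n zero    = ℕₚ.≤-refl
C-suc-≤ n (suc k) = subst (n C suc k ≤_) (nCk+nC[k+1]≡[n+1]C[k+1] n k) (ℕₚ.m≤n+m _ (n C k))

C-monoˡ : ∀ {m n} k → m ≤ n → m C k ≤ n C k
C-monoˡ {m} k m≤n = go (ℕₚ.≤⇒≤′ m≤n)
  where
  go : ∀ {n} → m ≤′ n → m C k ≤ n C k
  go ≤′-refl     = ℕₚ.≤-refl
  go (≤′-step p) = ℕₚ.≤-trans (go p) (C-suc-≤ _ k)

C≤^ : ∀ n k → n C k ≤ n ^ k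
C≤^ n       zero    = ℕₚ.≤-refl
C≤^ zero    (suc k) = z≤n
C≤^ (suc n) (suc k) = begin
  suc n C suc k           ≤⟨ ℕₚ.m≤m+n _ (k * (suc n C suc k)) ⟩
  suc k * (suc n C suc k) ≡⟨ C-absorption n k ⟩
  suc n * (n C k)         ≤⟨ ℕₚ.*-monoʳ-≤ (suc n) (ℕₚ.≤-trans (C-suc-≤ n k) (C≤^ (suc n) k)) ⟩
  suc n * suc n ^ k       ∎
  where open ℕₚ.≤-Reasoning

-- A set that meets the `s` points is given by one of them and j further points out of at most N.
C-remove : ∀ s z j {N} → s + z ≤ suc N → (s + z) C suc j ≤ z C suc j + s * (N C j)
C-remove zero    z j s+z≤ = ℕₚ.m≤m+n _ 0
C-remove (suc s) z j {N} s+z≤ = begin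
  suc (s + z) C suc j                     ≡⟨ nCk+nC[k+1]≡[n+1]C[k+1] (s + z) j ⟨
  (s + z) C j + (s + z) C suc j           ≤⟨ ℕₚ.+-mono-≤ (C-monoˡ j (ℕₚ.≤-pred s+z≤)) (C-remove s z j (ℕₚ.≤-trans (ℕₚ.n≤1+n _) s+z≤)) ⟩
  N C j + (z C suc j + s * (N C j))       ≡⟨ e (N C j) (z C suc j) s ⟩
  z C suc j + suc s * (N C j)             ∎
  where
  open ℕₚ.≤-Reasoning
  e : ∀ x y s → x + (y + s * x) ≡ y + suc s * x
  e = solve-∀

-- A random k-set contains sk/(s + z), at most 1/2, of the `s` points on average, so at least half
-- of the k-sets avoid them.
C-halve : ∀ s z k → 2 * s * k ≤ s + z → (s + z) C k ≤ 2 * (z C k)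
C-halve s       z       zero    _  = s≤s z≤n
C-halve zero    z       (suc j) _  = ℕₚ.m≤m+n _ _
C-halve (suc s) z       (suc j) 2sk≤n = ℕₚ.+-cancelʳ-≤ c c (2 * (z C suc j)) (begin
  c + c                                        ≡⟨ cong (c +_) (ℕₚ.+-identityʳ c) ⟨
  2 * c                                        ≤⟨ ℕₚ.*-monoʳ-≤ 2 (C-remove (suc s) z j ℕₚ.≤-refl) ⟩
  2 * (z C suc j + suc s * (N C j))            ≡⟨ ℕₚ.*-distribˡ-+ 2 (z C suc j) _ ⟩
  2 * (z C suc j) + 2 * (suc s * (N C j))      ≤⟨ ℕₚ.+-monoʳ-≤ (2 * (z C suc j)) removed ⟩
  2 * (z C suc j) + c                          ∎)
  where
  open ℕₚ.≤-Reasoning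
  N = s + z
  c = suc N C suc j
  e : ∀ s j c → 2 * s * j * c ≡ 2 * s * (j * c)
  e = solve-∀
  e₂ : ∀ n s d → n * (2 * (s * d)) ≡ 2 * s * (n * d)
  e₂ = solve-∀
  removed : 2 * (suc s * (N C j)) ≤ c
  removed = ℕₚ.*-cancelˡ-≤ (suc N) (begin
    suc N * (2 * (suc s * (N C j)))   ≡⟨ e₂ (suc N) (suc s) _ ⟩
    2 * suc s * (suc N * (N C j))     ≡⟨ cong (2 * suc s *_) (C-absorption N j) ⟨
    2 * suc s * (suc j * c)           ≡⟨ e (suc s) (suc j) c ⟨
    2 * suc s * suc j * c             ≤⟨ ℕₚ.*-monoˡ-≤ c 2sk≤n ⟩
    suc N * c                         ∎)

-- Absorption is applied twice, with every lowered n rounded back up.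
C-absorption₂ : ∀ n j → suc (suc j) * (suc j * (n C suc (suc j))) ≤ n * (n * (n C j))
C-absorption₂ zero    j = ℕₚ.≤-reflexive (trans (cong (suc (suc j) *_) (ℕₚ.*-zeroʳ (suc j))) (ℕₚ.*-zeroʳ (suc (suc j))))
C-absorption₂ (suc n) j = begin
  suc (suc j) * (suc j * c)             ≡⟨ e (suc (suc j)) (suc j) c ⟩
  suc j * (suc (suc j) * c)             ≡⟨ cong (suc j *_) (C-absorption n (suc j)) ⟩
  suc j * (suc n * (n C suc j))         ≡⟨ e (suc j) (suc n) _ ⟩
  suc n * (suc j * (n C suc j))         ≤⟨ ℕₚ.*-monoʳ-≤ (suc n) (ℕₚ.*-monoʳ-≤ (suc j) (C-suc-≤ n (suc j))) ⟩
  suc n * (suc j * (suc n C suc j))     ≡⟨ cong (suc n *_) (C-absorption n j) ⟩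
  suc n * (suc n * (n C j))             ≤⟨ ℕₚ.*-monoʳ-≤ (suc n) (ℕₚ.*-monoʳ-≤ (suc n) (C-suc-≤ n j)) ⟩
  suc n * (suc n * (suc n C j))         ∎
  where
  open ℕₚ.≤-Reasoning
  c = suc n C suc (suc j)
  e : ∀ a b c → a * (b * c) ≡ b * (a * c)
  e = solve-∀

^-distribʳ-* : ∀ k m n → (m * n) ^ k ≡ m ^ k * n ^ k
^-distribʳ-* zero    m n = refl
^-distribʳ-* (suc k) m n = trans (cong (m * n *_) (^-distribʳ-* k m n)) (e m n (m ^ k) (n ^ k))
  where e : ∀ a b c d → a * b * (c * d) ≡ a * c * (b * d)
        e = solve-∀

-- Block sizes and the density of favourable columns.

-- There are R blocks with two sides of 2kh rows each, and z remaining rows; the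
-- bounds make kh of order n / (R k).
record Layout (R k n : ℕ) : Set where
  field
    h z   : ℕ
    total : n ≡ R * (2 * (2 * (k * h))) + z
    small : 2 * (R * (2 * (2 * (k * h)))) * k ≤ n
    large : n ≤ 16 * R * k * k * h

layout : ∀ R′ k′ n → let R = suc R′; k = suc k′ in 8 * R * k * k ≤ n → Layout R k n
layout R′ k′ n Q≤n = record
  { h     = h
  ; z     = n ∸ s
  ; total = sym (ℕₚ.m+[n∸m]≡n (ℕₚ.≤-trans s≤2sk 2sk≤n))
  ; small = 2sk≤n
  ; large = large
  }
  where
  open ℕₚ.≤-Reasoning
  R = suc R′
  k = suc k′
  -- With this value 2sk equals hQ, so the quotient h is the largest choice satisfying `small`.
  Q = 8 * R * k * k
  h = n / Q
  s = R * (2 * (2 * (k * h)))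
  e : ∀ R k h → 2 * (R * (2 * (2 * (k * h)))) * k ≡ h * (8 * R * k * k)
  e = solve-∀
  2sk≤n : 2 * s * k ≤ n
  2sk≤n = ℕₚ.≤-trans (ℕₚ.≤-reflexive (e R k h)) (m/n*n≤m n Q)
  s≤2sk : s ≤ 2 * s * k
  s≤2sk = ℕₚ.≤-trans (ℕₚ.m≤m+n s _) (ℕₚ.m≤m*n (2 * s) k)
  e₂ : ∀ R k h → 8 * R * k * k * h + h * (8 * R * k * k) ≡ 16 * R * k * k * h
  e₂ = solve-∀
  large : n ≤ 16 * R * k * k * h
  large = begin
    n                      ≡⟨ m≡m%n+[m/n]*n n Q ⟩
    n % Q + h * Q          ≤⟨ ℕₚ.+-monoˡ-≤ (h * Q) (ℕₚ.<⇒≤ (m%n<n n Q)) ⟩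
    -- Q ≤ n gives h ≥ 1, so the remainder, being below Q, is at most Qh.
    Q + h * Q              ≤⟨ ℕₚ.+-monoˡ-≤ (h * Q) (ℕₚ.m≤m*n Q h {{(>-nonZero (m≥n⇒m/n>0 Q≤n))}}) ⟩
    Q * h + h * Q          ≡⟨ e₂ R k h ⟩
    16 * R * k * k * h     ∎

-- Because the constant is free of k, so is L_M.
layout-kernel-density : ∀ {R k₂ n} (L : Layout R (suc (suc k₂)) n) → let k = suc (suc k₂); kh = k * Layout.h L in
                        n C k ≤ 512 * R * R * (2 * kh * (Layout.z L C k₂) * kh)
layout-kernel-density {R} {k₂} {n} L = ℕₚ.*-cancelˡ-≤ k (ℕₚ.*-cancelˡ-≤ k (begin
  -- After multiplying by k^2, each factor n is replaced by a multiple of k * (k * h): the outer k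
  -- cancels, and k * h is, up to a constant, the number of choices of a block point.
  k * (k * N)                           ≤⟨ ℕₚ.*-monoʳ-≤ k k≤ ⟩
  k * (2 * (suc k₂ * N))                ≡⟨ e₁ k (suc k₂) N ⟩
  2 * (k * (suc k₂ * N))                ≤⟨ ℕₚ.*-monoʳ-≤ 2 (C-absorption₂ n k₂) ⟩
  2 * (n * (n * (n C k₂)))              ≤⟨ ℕₚ.*-monoʳ-≤ 2 (ℕₚ.*-mono-≤ large (ℕₚ.*-mono-≤ large nCk₂≤)) ⟩
  2 * (q * (q * (2 * c)))               ≡⟨ e₂ R k h c ⟩
  k * (k * (512 * R * R * (a * c * (k * h)))) ∎))
  where
  open ℕₚ.≤-Reasoning
  open Layout L
  k a c N q : ℕ
  k = suc (suc k₂)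
  a = 2 * (k * h)
  c = z C k₂
  N = n C k
  q = 16 * R * k * k * h
  e₁ : ∀ a b c → a * (2 * (b * c)) ≡ 2 * (a * (b * c))
  e₁ = solve-∀
  e₂ : ∀ R k h c → 2 * (16 * R * k * k * h * (16 * R * k * k * h * (2 * c)))
                   ≡ k * (k * (512 * R * R * (2 * (k * h) * c * (k * h))))
  e₂ = solve-∀
  k≤ : k * N ≤ 2 * (suc k₂ * N)
  k≤ = begin
    k * N              ≤⟨ ℕₚ.*-monoˡ-≤ N (s≤s (s≤s (ℕₚ.m≤n+m k₂ k₂))) ⟩
    suc (suc (k₂ + k₂)) * N ≡⟨ e₃ k₂ N ⟩
    2 * (suc k₂ * N)   ∎
    where e₃ : ∀ x N → suc (suc (x + x)) * N ≡ 2 * (suc x * N)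
          e₃ = solve-∀
  nCk₂≤ : n C k₂ ≤ 2 * c
  -- At least half of all k₂-sets of rows avoid the blocks; `small` is stated for the larger k.
  nCk₂≤ = subst (λ m → m C k₂ ≤ 2 * c) (sym total) (C-halve _ z k₂
    (subst (2 * (R * (2 * a)) * k₂ ≤_) total
      (ℕₚ.≤-trans (ℕₚ.*-monoʳ-≤ (2 * (R * (2 * a))) (ℕₚ.≤-trans (ℕₚ.n≤1+n k₂) (ℕₚ.n≤1+n (suc k₂)))) small)))

-- The crude bound n^k suffices: this constant may depend on k, since it enters only the threshold
-- for n.
layout-transversal-density : ∀ {R k n} (L : Layout R k n) → n C k ≤ (16 * R * k * k) ^ k * Layout.h L ^ k
layout-transversal-density {R} {k} {n} L = begin
  n C k                          ≤⟨ C≤^ n k ⟩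
  n ^ k                          ≤⟨ ℕₚ.^-monoˡ-≤ k large ⟩
  (16 * R * k * k * h) ^ k       ≡⟨ ^-distribʳ-* k (16 * R * k * k) h ⟩
  (16 * R * k * k) ^ k * h ^ k   ∎
  where open ℕₚ.≤-Reasoning
        open Layout L

-- Row sets as sums of unit vectors, and transversals.

lookup-⁅x⁆ : ∀ {n} (x : Fin n) → lookup ⁅ x ⁆ x ≡ true
lookup-⁅x⁆ x = []=⇒lookup (x∈⁅x⁆ x)

lookup-⁅y⁆ : ∀ {n} {x y : Fin n} → x ≢ y → lookup ⁅ y ⁆ x ≡ false
lookup-⁅y⁆ {x = x} {y} x≢y with lookup ⁅ y ⁆ x in eq
... | false = refl
... | true  = contradiction (x∈⁅y⁆⇒x≡y y (lookup⇒[]= x ⁅ y ⁆ eq)) x≢y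

lookup-⁅y⁆⊕ : ∀ {n} {x y : Fin n} {S : Subset n} → x ≢ y → lookup S x ≡ false → lookup (⁅ y ⁆ ⊕ S) x ≡ false
lookup-⁅y⁆⊕ {x = x} {y} {S} x≢y S[x] =
  trans (lookup-zipWith _xor_ x ⁅ y ⁆ S) (cong₂ _xor_ (lookup-⁅y⁆ x≢y) S[x])

-- The coordinate x is 1 on the left, and on the right only `⁅ y ⁆` can contribute it; the rest
-- follows by cancelling.
⁅⁆⊕-injective : ∀ {n} {x y : Fin n} {S T : Subset n} → lookup S x ≡ false → lookup T x ≡ false →
                ⁅ x ⁆ ⊕ S ≡ ⁅ y ⁆ ⊕ T → x ≡ y × S ≡ T
⁅⁆⊕-injective {x = x} {y} {S} {T} S[x] T[x] eq with x Finₚ.≟ y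
... | yes refl = refl , trans (sym (⊕-cancelˡ ⁅ x ⁆ S)) (trans (cong (⁅ x ⁆ ⊕_) eq) (⊕-cancelˡ ⁅ x ⁆ T))
... | no x≢y   = contradiction (trans (sym in-left) (trans (cong (λ U → lookup U x) eq) (lookup-⁅y⁆⊕ x≢y T[x]))) λ ()
  where in-left : lookup (⁅ x ⁆ ⊕ S) x ≡ true
        in-left = trans (lookup-zipWith _xor_ x ⁅ x ⁆ S) (cong₂ _xor_ (lookup-⁅x⁆ x) S[x])

∣⁅x⁆⊕S∣ : ∀ {n} (x : Fin n) (S : Subset n) → lookup S x ≡ false → ∣ ⁅ x ⁆ ⊕ S ∣ ≡ suc ∣ S ∣
∣⁅x⁆⊕S∣ zero    (false ∷ S) refl = cong suc (cong ∣_∣ (⊕-identityˡ S))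
∣⁅x⁆⊕S∣ (suc x) (true  ∷ S) S[x] = cong suc (∣⁅x⁆⊕S∣ x S S[x])
∣⁅x⁆⊕S∣ (suc x) (false ∷ S) S[x] = ∣⁅x⁆⊕S∣ x S S[x]

∣0++S∣ : ∀ m {n} (S : Subset n) → ∣ zeroVec {m} ++ S ∣ ≡ ∣ S ∣
∣0++S∣ zero    S = refl
∣0++S∣ (suc m) S = ∣0++S∣ m S

∣0∣ : ∀ n → ∣ zeroVec {n} ∣ ≡ 0
∣0∣ zero    = refl
∣0∣ (suc n) = ∣0∣ n

sumCols-map-false∷ : ∀ {n m} (cols : Vec (GF2Vec n) m) T →
                     sumCols (mapᵛ (false ∷_) cols) T ≡ false ∷ sumCols cols T
sumCols-map-false∷ []         []          = refl
sumCols-map-false∷ (c ∷ cols) (true  ∷ T) = cong ((false ∷ c) ⊕_) (sumCols-map-false∷ cols T)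
sumCols-map-false∷ (c ∷ cols) (false ∷ T) = cong (zeroVec ⊕_) (sumCols-map-false∷ cols T)

sumCols-basis : ∀ {n} (v : GF2Vec n) → sumCols (tabulate ⁅_⁆) v ≡ v
sumCols-basis []      = refl
sumCols-basis (b ∷ v) = begin
  b·e ⊕ sumCols (tabulate (λ i → false ∷ ⁅ i ⁆)) v          ≡⟨ cong (λ cols → b·e ⊕ sumCols cols v) (tabulate-∘ (false ∷_) ⁅_⁆) ⟩
  b·e ⊕ sumCols (mapᵛ (false ∷_) (tabulate ⁅_⁆)) v          ≡⟨ cong (b·e ⊕_) (sumCols-map-false∷ (tabulate ⁅_⁆) v) ⟩
  b·e ⊕ (false ∷ sumCols (tabulate ⁅_⁆) v)                  ≡⟨ cong (λ u → b·e ⊕ (false ∷ u)) (sumCols-basis v) ⟩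
  b·e ⊕ (false ∷ v)                                         ≡⟨ head-bit b ⟩
  b ∷ v                                                     ∎
  where
  open ≡-Reasoning
  b·e = if b then ⁅ zero ⁆ else zeroVec
  head-bit : ∀ b → (if b then ⁅ zero ⁆ else zeroVec) ⊕ (false ∷ v) ≡ b ∷ v
  head-bit true  = cong (true ∷_) (⊕-identityˡ v)
  head-bit false = cong (false ∷_) (⊕-identityˡ v)

-- `P i` lists the choices for position i: the lists are repetition-free and pairwise disjoint.
Disjoint : ∀ {k h n} → (Fin k → Fin h → Fin n) → Set
Disjoint P = ∀ {i j s t} → P i s ≡ P j t → i ≡ j × s ≡ t

transversal : ∀ {k h n} → (Fin k → Fin h → Fin n) → Vec (Fin h) k → Subset n
transversal P []       = zeroVec
transversal P (t ∷ ts) = ⁅ P zero t ⁆ ⊕ transversal (P ∘ suc) ts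

transversal-∌ : ∀ {k h n} (P : Fin k → Fin h → Fin n) ts {x} → (∀ j t → x ≢ P j t) →
                lookup (transversal P ts) x ≡ false
transversal-∌ P []       {x} x≢ = lookup-replicate x false
transversal-∌ P (t ∷ ts)     x≢ = lookup-⁅y⁆⊕ (x≢ zero t) (transversal-∌ (P ∘ suc) ts (x≢ ∘ suc))

disjoint-tail : ∀ {k h n} {P : Fin (suc k) → Fin h → Fin n} → Disjoint P → Disjoint (P ∘ suc)
disjoint-tail d eq with d eq
... | refl , s≡t = refl , s≡t

head-∌ : ∀ {k h n} {P : Fin (suc k) → Fin h → Fin n} → Disjoint P → ∀ t ts →
         lookup (transversal (P ∘ suc) ts) (P zero t) ≡ false
head-∌ {P = P} d t ts = transversal-∌ (P ∘ suc) ts (λ j s eq → contradiction (proj₁ (d eq)) λ ())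

transversal-injective : ∀ {k h n} {P : Fin k → Fin h → Fin n} → Disjoint P →
                        ∀ {ts ts′} → transversal P ts ≡ transversal P ts′ → ts ≡ ts′
transversal-injective d {[]}     {[]}       eq = refl
transversal-injective {P = P} d {t ∷ ts} {t′ ∷ ts′} eq with ⁅⁆⊕-injective (head-∌ {P = P} d t ts) (head-∌ {P = P} d t ts′) eq
... | t≡ , ts≡ = cong₂ _∷_ (proj₂ (d t≡)) (transversal-injective {P = P ∘ suc} (disjoint-tail {P = P} d) ts≡)

∣transversal∣ : ∀ {k h n} {P : Fin k → Fin h → Fin n} → Disjoint P → ∀ ts → ∣ transversal P ts ∣ ≡ k
∣transversal∣ {n = n} d []       = ∣0∣ n
∣transversal∣ {P = P} d (t ∷ ts) =
  trans (∣⁅x⁆⊕S∣ (P zero t) _ (head-∌ {P = P} d t ts)) (cong suc (∣transversal∣ {P = P ∘ suc} (disjoint-tail {P = P} d) ts))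

-- With labels for φ this is the image of a column under π; with the partners for φ it is the class
-- of the column modulo the contracted ones.
blockSum : ∀ {R n k} → (Fin R → GF2Vec n) → Vec (Fin R) k → GF2Vec n
blockSum φ []       = zeroVec
blockSum φ (b ∷ bs) = φ b ⊕ blockSum φ bs

-- A coordinate 0 of β is filled with block 0 instead of being left out, because every column must
-- have the same size.
choose : ∀ {r R} k₃ → (Fin r → Fin (suc R)) → GF2Vec r → Vec (Fin (suc R)) (r + k₃)
choose k₃ ι []      = replicate k₃ zero
choose k₃ ι (b ∷ β) = (if b then ι zero else zero) ∷ choose k₃ (ι ∘ suc) β

-- Replacing block 0 by block `ι j` changes the sum by `φ (ι j) ⊕ φ zero`, so the sum is affine in
-- β.
blockSum-choose : ∀ {n r R} k₃ (φ : Fin (suc R) → GF2Vec n) (ι : Fin r → Fin (suc R)) β →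
  blockSum φ (choose k₃ ι β) ≡
  blockSum φ (replicate (r + k₃) zero) ⊕ sumCols (tabulate (λ j → φ (ι j) ⊕ φ zero)) β
blockSum-choose k₃ φ ι []      = sym (⊕-identityʳ _)
blockSum-choose {r = suc r} k₃ φ ι (b ∷ β) = begin
  φ (if b then ι zero else zero) ⊕ blockSum φ (choose k₃ (ι ∘ suc) β)
    ≡⟨ cong₂ _⊕_ (swap b) (blockSum-choose k₃ φ (ι ∘ suc) β) ⟩
  (φ zero ⊕ y) ⊕ (blockSum φ (replicate (r + k₃) zero) ⊕ sumCols Y β)
    ≡⟨ ⊕-interchange (φ zero) y _ _ ⟩
  (φ zero ⊕ blockSum φ (replicate (r + k₃) zero)) ⊕ (y ⊕ sumCols Y β) ∎
  where
  open ≡-Reasoning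
  Y = tabulate (λ j → φ (ι (suc j)) ⊕ φ zero)
  y = if b then φ (ι zero) ⊕ φ zero else zeroVec
  swap : ∀ b → φ (if b then ι zero else zero) ≡ φ zero ⊕ (if b then φ (ι zero) ⊕ φ zero else zeroVec)
  swap true  = sym (trans (cong (φ zero ⊕_) (⊕-comm (φ (ι zero)) (φ zero))) (⊕-cancelˡ (φ zero) (φ (ι zero))))
  swap false = sym (⊕-identityʳ (φ zero))

sumCols-transversal : ∀ {R r n h k} (labels : Vec (GF2Vec r) n) (φ : Fin R → GF2Vec r)
  (P : Fin k → Fin h → Fin n) (bs : Vec (Fin R) k) → (∀ j t → lookup labels (P j t) ≡ φ (lookup bs j)) →
  ∀ ts → sumCols labels (transversal P ts) ≡ blockSum φ bs
sumCols-transversal labels φ P []       lab []       = sumCols-0 labels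
sumCols-transversal labels φ P (b ∷ bs) lab (t ∷ ts) = trans (sumCols-⊕ labels _ _)
  (cong₂ _⊕_ (trans (sumCols-⁅⁆ labels (P zero t)) (lab zero t))
             (sumCols-transversal labels φ (P ∘ suc) bs (lab ∘ suc) ts))

-- The congruences of the single points modulo `ws` add up.
span-transversal : ∀ {R n h k l} (ws : Vec (GF2Vec n) l) (φ : Fin R → GF2Vec n)
  (P : Fin k → Fin h → Fin n) (bs : Vec (Fin R) k) → (∀ j t → Span ws (⁅ P j t ⁆ ⊕ φ (lookup bs j))) →
  ∀ ts → Span ws (transversal P ts ⊕ blockSum φ bs)
span-transversal ws φ P []       sp []       = subst (Span ws) (sym (⊕-identityˡ _)) (span-0 ws)
span-transversal ws φ P (b ∷ bs) sp (t ∷ ts) = subst (Span ws) (⊕-interchange _ _ _ _)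
  (span-⊕ ws (sp zero t) (span-transversal ws φ (P ∘ suc) bs (sp ∘ suc) ts))

-- The labelled rows and the kernel columns.

-- The rows: r + 1 blocks, each split into two sides of a points, followed by
-- z further points. Block 0 and the further points are labelled 0, block i + 1 is
-- labelled by the i-th unit vector.
module Blocks (r a z : ℕ) where

  s n : ℕ
  s = suc r * (2 * a)
  n = s + z

  pos : Fin (suc r) → Fin 2 → Fin a → Fin s
  pos b i x = combine b (combine i x)

  pt : Fin (suc r) → Fin 2 → Fin a → Fin n
  pt b i x = pos b i x ↑ˡ z

  pt-injective : ∀ b i x b′ i′ x′ → pt b i x ≡ pt b′ i′ x′ → b ≡ b′ × i ≡ i′ × x ≡ x′
  pt-injective b i x b′ i′ x′ eq with Finₚ.combine-injective b _ b′ _ (Finₚ.↑ˡ-injective z _ _ eq)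
  ... | b≡ , ix≡ = b≡ , Finₚ.combine-injective i x i′ x′ ix≡

  blockLabel : Fin (suc r) → GF2Vec r
  blockLabel zero    = zeroVec
  blockLabel (suc i) = ⁅ i ⁆

  labels : Vec (GF2Vec r) n
  labels = tabulate (blockLabel ∘ proj₁ ∘ remQuot {suc r} (2 * a)) ++ replicate z zeroVec

  π : GF2Vec n → GF2Vec r
  π = sumCols labels

  lookup-labels : ∀ b i x → lookup labels (pt b i x) ≡ blockLabel b
  lookup-labels b i x = begin
    lookup labels (pt b i x)                                        ≡⟨ lookup-++ˡ labelsₛ (replicate z zeroVec) (pos b i x) ⟩
    lookup labelsₛ (pos b i x)                                      ≡⟨ lookup∘tabulate _ (pos b i x) ⟩
    blockLabel (proj₁ (remQuot {suc r} (2 * a) (pos b i x)))       ≡⟨ cong (blockLabel ∘ proj₁) (Finₚ.remQuot-combine b (combine i x)) ⟩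
    blockLabel b                                                    ∎
    where open ≡-Reasoning
          labelsₛ = tabulate (blockLabel ∘ proj₁ ∘ remQuot {suc r} (2 * a))

  π-pt : ∀ b i x → π ⁅ pt b i x ⁆ ≡ blockLabel b
  π-pt b i x = trans (sumCols-⁅⁆ labels (pt b i x)) (lookup-labels b i x)

  tail : Subset z → GF2Vec n
  tail D = zeroVec {s} ++ D

  π-tail : ∀ D → π (tail D) ≡ zeroVec
  π-tail D = trans (sumCols-++ labelsₛ (replicate z zeroVec) zeroVec D)
    (trans (cong₂ _⊕_ (sumCols-0 labelsₛ) (sumCols-replicate-0 z D)) (⊕-identityˡ _))
    where labelsₛ = tabulate (blockLabel ∘ proj₁ ∘ remQuot {suc r} (2 * a))

  tail-∌ : ∀ D b i x → lookup (tail D) (pt b i x) ≡ false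
  tail-∌ D b i x = trans (lookup-++ˡ (zeroVec {s}) D (pos b i x)) (lookup-replicate (pos b i x) false)

  -- The part of a kernel column that does not involve x: the column lies in a span exactly when the
  -- point x is congruent to this vector.
  partner : Fin (suc r) → Fin a → Subset z → GF2Vec n
  partner b y D = ⁅ pt b (suc zero) y ⁆ ⊕ tail D

  kernelColumn : Fin (suc r) → Fin a → Subset z → Fin a → GF2Vec n
  kernelColumn b y D x = ⁅ pt b zero x ⁆ ⊕ partner b y D

  -- The two block points have equal labels, which cancel, and the tail is labelled 0.
  π-kernelColumn : ∀ b y D x → π (kernelColumn b y D x) ≡ zeroVec
  π-kernelColumn b y D x = begin
    π (kernelColumn b y D x)                               ≡⟨ sumCols-⊕ labels _ _ ⟩
    π ⁅ pt b zero x ⁆ ⊕ π (partner b y D)                  ≡⟨ cong₂ _⊕_ (π-pt b zero x) (sumCols-⊕ labels _ _) ⟩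
    blockLabel b ⊕ (π ⁅ pt b (suc zero) y ⁆ ⊕ π (tail D))  ≡⟨ cong₂ (λ u v → blockLabel b ⊕ (u ⊕ v)) (π-pt b (suc zero) y) (π-tail D) ⟩
    blockLabel b ⊕ (blockLabel b ⊕ zeroVec)                ≡⟨ ⊕-cancelˡ (blockLabel b) zeroVec ⟩
    zeroVec                                                ∎
    where open ≡-Reasoning

  partner-∌ : ∀ b y D x → lookup (partner b y D) (pt b zero x) ≡ false
  partner-∌ b y D x = lookup-⁅y⁆⊕ {S = tail D}
    (λ eq → contradiction (proj₁ (proj₂ (pt-injective b zero x b (suc zero) y eq))) λ ()) (tail-∌ D b zero x)

  ∣kernelColumn∣ : ∀ b y D x → ∣ kernelColumn b y D x ∣ ≡ suc (suc ∣ D ∣)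
  ∣kernelColumn∣ b y D x = trans (∣⁅x⁆⊕S∣ (pt b zero x) (partner b y D) (partner-∌ b y D x))
    (cong suc (trans (∣⁅x⁆⊕S∣ (pt b (suc zero) y) (tail D) (tail-∌ D b (suc zero) y)) (cong suc (∣0++S∣ s D))))

  kernelColumn-injective : ∀ b {y D x y′ D′ x′} → kernelColumn b y D x ≡ kernelColumn b y′ D′ x′ →
                           y ≡ y′ × D ≡ D′ × x ≡ x′
  kernelColumn-injective b {y} {D} {x} {y′} {D′} {x′} eq
    with ⁅⁆⊕-injective (partner-∌ b y D x) (partner-∌ b y′ D′ x) eq
  ... | ptx≡ , partner≡ with ⁅⁆⊕-injective (tail-∌ D b (suc zero) y) (tail-∌ D′ b (suc zero) y) partner≡
  ...   | pty≡ , tail≡ = proj₂ (proj₂ (pt-injective b (suc zero) y b (suc zero) y′ pty≡)) ,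
                         ++-injectiveʳ (zeroVec {s}) zeroVec tail≡ ,
                         proj₂ (proj₂ (pt-injective b zero x b zero x′ ptx≡))

-- Favourable columns in each of the two phases.

module Phases (r k₃ h z : ℕ) where

  k₂ k a : ℕ
  k₂ = r + k₃
  k = suc (suc k₂)
  a = 2 * (k * h)

  open Blocks r a z public

  Column : Set
  Column = GF2Vec n

  columns : List Column
  columns = subsetsOfSize n k

  linked : ∀ {l} → Vec Column l → Fin (suc r) → Fin a → Subset z → ℕ
  linked ws b y D = count (λ x → span? ws (kernelColumn b y D x)) (allFin a)

  -- In every block, half of the points are congruent to a common vector, the
  -- partner, modulo the span of ws.
  Linked : ∀ {l} → Vec Column l → Set
  Linked ws = ∀ b → ∃ λ y → ∃ λ D → ∣ D ∣ ≡ k₂ × k * h ≤ linked ws b y D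

  abstract
    linkedBlock? : ∀ {l} (ws : Vec Column l) b → Dec (∃ λ y → ∃ λ D → ∣ D ∣ ≡ k₂ × k * h ≤ linked ws b y D)
    linkedBlock? ws b = Finₚ.any? λ y → anySubset? λ D → (∣ D ∣ ≟ k₂) ×-dec (k * h ≤? linked ws b y D)

    linked? : ∀ {l} (ws : Vec Column l) → Dec (Linked ws)
    linked? ws = Finₚ.all? (linkedBlock? ws)

  -- Spans only grow, so linkage is never lost once it is reached.
  linked-∷ : ∀ {l} c (ws : Vec Column l) → Linked ws → Linked (c ∷ ws)
  linked-∷ c ws lk b with lk b
  ... | y , D , D≡ , kh≤ = y , D , D≡ ,
    ℕₚ.≤-trans kh≤ (count-mono (λ x → span? ws (kernelColumn b y D x)) (λ x → span? (c ∷ ws) (kernelColumn b y D x))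
                     (allFin a) (λ x → span-∷ c ws))

  Fresh : ∀ {l} → Vec Column l → Column → Set
  Fresh ws c = π c ≡ zeroVec × ¬ Span ws c

  abstract
    fresh? : ∀ {l} (ws : Vec Column l) c → Dec (Fresh ws c)
    fresh? ws c = (π c ≟ᵛ zeroVec) ×-dec ¬? (span? ws c)

  -- Some block has no partner: for each of its y and D at least half of the x give a kernel column
  -- outside the span, and different triples give different columns.
  many-fresh : ∀ {l} (ws : Vec Column l) → ¬ Linked ws → a * (z C k₂) * (k * h) ≤ count (fresh? ws) columns
  many-fresh ws ¬lk with Finₚ.¬∀⟶∃¬ (suc r) _ (linkedBlock? ws) ¬lk
  ... | b , ¬lkb = ℕₚ.≤-trans enough (unique⇒length≤count (fresh? ws) candidates-unique candidates⊆)
    where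
    U : List (Fin a × Subset z)
    U = cartesianProduct (allFin a) (subsetsOfSize z k₂)
    col : (Fin a × Subset z) × Fin a → Column
    col ((y , D) , x) = kernelColumn b y D x
    unlinked? : ∀ c → Dec (¬ Span ws c)
    unlinked? c = ¬? (span? ws c)
    candidates : List Column
    candidates = filter unlinked? (map col (cartesianProduct U (allFin a)))

    col-injective : ∀ {p q} → col p ≡ col q → p ≡ q
    col-injective eq with kernelColumn-injective b eq
    ... | refl , refl , refl = refl

    candidates-unique = Uniqueₚ.filter⁺ unlinked? (Uniqueₚ.map⁺ col-injective
      (Uniqueₚ.cartesianProduct⁺ (Uniqueₚ.cartesianProduct⁺ (Uniqueₚ.allFin⁺ a) (subsetsOfSize-unique z k₂)) (Uniqueₚ.allFin⁺ a)))

    candidates⊆ : ∀ {c} → c ∈ₗ candidates → c ∈ₗ columns × Fresh ws c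
    candidates⊆ c∈ with ∈ₚ.∈-filter⁻ unlinked? c∈
    ... | c∈′ , c∉span with ∈ₚ.∈-map⁻ col c∈′
    ...   | ((y , D) , x) , p∈ , refl =
      subst (λ i → kernelColumn b y D x ∈ₗ subsetsOfSize n i)
            (trans (∣kernelColumn∣ b y D x) (cong (λ i → suc (suc i)) ∣D∣≡k₂)) (subsetsOfSize⁺ (kernelColumn b y D x)) ,
      π-kernelColumn b y D x , c∉span
      where
      ∣D∣≡k₂ : ∣ D ∣ ≡ k₂
      ∣D∣≡k₂ = subsetsOfSize⁻ z k₂ (proj₂ (∈ₚ.∈-cartesianProduct⁻ (allFin a) (subsetsOfSize z k₂)
                 (proj₁ (∈ₚ.∈-cartesianProduct⁻ U (allFin a) p∈))))

    -- Fewer than kh of the 2kh points are congruent to this partner, so at least kh are not.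
    half : ∀ u → u ∈ₗ U → k * h ≤ count (λ x → unlinked? (col (u , x))) (allFin a)
    half (y , D) u∈ = ℕₚ.+-cancelˡ-≤ (k * h) _ _ (begin
      k * h + k * h                                    ≡⟨ cong (k * h +_) (ℕₚ.+-identityʳ (k * h)) ⟨
      a                                                ≡⟨ length-tabulate {n = a} id ⟨
      length (allFin a)                                ≡⟨ count-¬ (λ x → span? ws (kernelColumn b y D x)) (allFin a) ⟨
      linked ws b y D + count (λ x → unlinked? (col ((y , D) , x))) (allFin a)
        ≤⟨ ℕₚ.+-monoˡ-≤ _ (ℕₚ.<⇒≤ (ℕₚ.≰⇒> (λ kh≤ → ¬lkb (y , D , ∣D∣≡k₂ , kh≤)))) ⟩
      k * h + count (λ x → unlinked? (col ((y , D) , x))) (allFin a) ∎)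
      where
      open ℕₚ.≤-Reasoning
      ∣D∣≡k₂ : ∣ D ∣ ≡ k₂
      ∣D∣≡k₂ = subsetsOfSize⁻ z k₂ (proj₂ (∈ₚ.∈-cartesianProduct⁻ (allFin a) (subsetsOfSize z k₂) u∈))

    length-U : length U ≡ a * (z C k₂)
    length-U = trans (length-product _,_ (allFin a) (subsetsOfSize z k₂))
      (cong₂ _*_ (length-tabulate {n = a} id) (length-subsetsOfSize z k₂))

    enough : a * (z C k₂) * (k * h) ≤ length candidates
    enough = begin
      a * (z C k₂) * (k * h)      ≡⟨ cong (_* (k * h)) length-U ⟨
      length U * (k * h)          ≡⟨ sumOver-const (k * h) U ⟨
      sumOver (λ _ → k * h) U     ≤⟨ sumOver-mono U half ⟩
      sumOver (λ u → count (λ x → unlinked? (col (u , x))) (allFin a)) U ≡⟨ sumOver-product _ _,_ U (allFin a) ⟨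
      count (λ p → unlinked? (col p)) (cartesianProduct U (allFin a))   ≡⟨ sumOver-map _ col (cartesianProduct U (allFin a)) ⟨
      count unlinked? (map col (cartesianProduct U (allFin a)))         ≡⟨ length-filter≡count unlinked? (map col (cartesianProduct U (allFin a))) ⟨
      length candidates           ∎
      where open ℕₚ.≤-Reasoning

  module Targets {l} (ws : Vec Column l) (lk : Linked ws) where

    anchor : Fin (suc r) → Column
    anchor b with lk b
    ... | y , D , _ = partner b y D

    κ : Column
    κ = blockSum anchor (replicate k zero)

    Y : Vec Column r
    Y = tabulate (λ j → anchor (suc j) ⊕ anchor zero)

    -- `κ` is the class of k points in block 0, and moving one of them to block j + 1 adds the j-th
    -- vector of `Y`. So the class is affine in β, while the label is β itself.
    Target : GF2Vec r → Column → Set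
    Target β c = π c ≡ β × Span ws (c ⊕ (κ ⊕ sumCols Y β))

    target? : ∀ β c → Dec (Target β c)
    target? β c = (π c ≟ᵛ β) ×-dec span? ws (c ⊕ (κ ⊕ sumCols Y β))

    -- As many as k * h points are selected so that the k positions can get disjoint groups of h,
    -- even if all lie in one block.
    class : ∀ b → Σ (Fin (k * h) → Fin a) λ g →
                    (∀ {i j} → g i ≡ g j → i ≡ j) × (∀ i → Span ws (⁅ pt b zero (g i) ⁆ ⊕ anchor b))
    class b with lk b
    ... | y , D , _ , kh≤ = g , g-injective , (λ i → proj₂ (∈ₚ.∈-filter⁻ sp? {xs = allFin a} (∈ₚ.∈-lookup (ι i))))
      where
      sp? : ∀ x → Dec (Span ws (kernelColumn b y D x))
      sp? x = span? ws (kernelColumn b y D x)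
      xs = filter sp? (allFin a)
      kh≤length : k * h ≤ length xs
      kh≤length = subst (k * h ≤_) (sym (length-filter≡count sp? (allFin a))) kh≤
      ι : Fin (k * h) → Fin (length xs)
      ι i = inject≤ i kh≤length
      g : Fin (k * h) → Fin a
      g i = lookupₗ xs (ι i)
      g-injective : ∀ {i j} → g i ≡ g j → i ≡ j
      g-injective eq = Finₚ.inject≤-injective kh≤length kh≤length _ _
        (lookup-injective (Uniqueₚ.filter⁺ sp? (Uniqueₚ.allFin⁺ a)) eq)

    -- The two extra zeros bring the length r + k₃ up to k.
    blocks : GF2Vec r → Vec (Fin (suc r)) k
    blocks β = zero ∷ zero ∷ choose k₃ suc β

    blockSum-blocks : ∀ {m} (φ : Fin (suc r) → GF2Vec m) β →
      blockSum φ (blocks β) ≡ blockSum φ (replicate k zero) ⊕ sumCols (tabulate (λ j → φ (suc j) ⊕ φ zero)) β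
    blockSum-blocks φ β = begin
      φ zero ⊕ (φ zero ⊕ blockSum φ (choose k₃ suc β)) ≡⟨ cong (λ u → φ zero ⊕ (φ zero ⊕ u)) (blockSum-choose k₃ φ suc β) ⟩
      φ zero ⊕ (φ zero ⊕ (rest ⊕ σ))                   ≡⟨ cong (φ zero ⊕_) (⊕-assoc (φ zero) rest σ) ⟨
      φ zero ⊕ ((φ zero ⊕ rest) ⊕ σ)                   ≡⟨ ⊕-assoc (φ zero) (φ zero ⊕ rest) σ ⟨
      (φ zero ⊕ (φ zero ⊕ rest)) ⊕ σ                   ∎
      where
      open ≡-Reasoning
      rest = blockSum φ (replicate k₂ zero)
      σ = sumCols (tabulate (λ j → φ (suc j) ⊕ φ zero)) β

    blockSum-label : ∀ β → blockSum blockLabel (blocks β) ≡ β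
    blockSum-label β = begin
      blockSum blockLabel (blocks β)              ≡⟨ blockSum-blocks blockLabel β ⟩
      blockSum blockLabel (replicate k zero) ⊕ _  ≡⟨ cong₂ _⊕_ (zeros k) (cong (λ c → sumCols c β) (tabulate-cong (λ j → ⊕-identityʳ ⁅ j ⁆))) ⟩
      zeroVec ⊕ sumCols (tabulate ⁅_⁆) β          ≡⟨ ⊕-identityˡ _ ⟩
      sumCols (tabulate ⁅_⁆) β                    ≡⟨ sumCols-basis β ⟩
      β                                           ∎
      where
      open ≡-Reasoning
      zeros : ∀ i → blockSum blockLabel (replicate i zero) ≡ zeroVec
      zeros zero    = refl
      zeros (suc i) = trans (⊕-identityˡ _) (zeros i)

    -- Each position has h free choices, and disjointness of the groups makes the resulting
    -- transversals distinct k-sets.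
    many-targets : ∀ β → h ^ k ≤ count (target? β) columns
    many-targets β = subst (_≤ count (target? β) columns)
      (trans (length-map (transversal P) (seqs (allFin h) k))
             (trans (length-seqs (allFin h) k) (cong (_^ k) (length-tabulate {n = h} id))))
      (unique⇒length≤count (target? β)
        (Uniqueₚ.map⁺ (transversal-injective {P = P} P-disjoint) (seqs-unique (Uniqueₚ.allFin⁺ h) k))
        λ c∈ → is-target c∈)
      where
      bs = blocks β
      P : Fin k → Fin h → Fin n
      -- Position j draws from the j-th group of h points in the class of its block.
      P j t = pt (lookup bs j) zero (proj₁ (class (lookup bs j)) (combine j t))
      P-disjoint : Disjoint P
      P-disjoint {i} {j} {s} {t} eq with pt-injective (lookup bs i) zero _ (lookup bs j) zero _ eq
      ... | b≡ , _ , g≡ = Finₚ.combine-injective i s j t (go b≡ g≡)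
        where
        go : ∀ {b b′ p q} → b ≡ b′ → proj₁ (class b) p ≡ proj₁ (class b′) q → p ≡ q
        go {b} refl eq = proj₁ (proj₂ (class b)) eq
      is-target : ∀ {c} → c ∈ₗ map (transversal P) (seqs (allFin h) k) → c ∈ₗ columns × Target β c
      is-target c∈ with ∈ₚ.∈-map⁻ (transversal P) c∈
      ... | ts , _ , refl =
        subst (λ i → transversal P ts ∈ₗ subsetsOfSize n i) (∣transversal∣ {P = P} P-disjoint ts) (subsetsOfSize⁺ (transversal P ts)) ,
        trans (sumCols-transversal labels blockLabel P bs (λ j t → lookup-labels (lookup bs j) zero _) ts) (blockSum-label β) ,
        subst (λ u → Span ws (transversal P ts ⊕ u)) (blockSum-blocks anchor β)
          (span-transversal ws anchor P bs (λ j t → proj₂ (proj₂ (class (lookup bs j))) (combine j t)) ts)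

-- Auxiliary facts on picks, conditional sums and powers.

pick-delete : ∀ {n t m l e} (v : Vec (GF2Vec n) t) {cols : Vec (GF2Vec n) m} {ws : Vec (GF2Vec n) l} {vs : Vec (GF2Vec n) e} →
              Pick cols ws vs → Pick (v ++ cols) ws vs
pick-delete []      p = p
pick-delete (c ∷ v) p = skip c (pick-delete v p)

pick-hits : ∀ {n t m l e} {B : Set} {P : B → GF2Vec n → Set} (bs : Vec B e) (v : Vec (GF2Vec n) t)
            {cols : Vec (GF2Vec n) m} {ws : Vec (GF2Vec n) l} → Pick cols ws [] → Hits {P = P} (toList bs) v →
            ∃ λ (vs : Vec (GF2Vec n) e) → Pick (v ++ cols) ws vs × Pointwise P bs vs
pick-hits []       v       p _              = [] , pick-delete v p , []
pick-hits (b ∷ bs) (c ∷ v) p (inj₁ (pc , hits)) with pick-hits bs v p hits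
... | vs , p′ , all = c ∷ vs , keep c p′ , pc ∷ all
pick-hits (b ∷ bs) (c ∷ v) p (inj₂ hits) with pick-hits (b ∷ bs) v p hits
... | vs , p′ , all = vs , skip c p′ , all

if-⊕ : ∀ {n} b (u v : GF2Vec n) →
       (if b then u ⊕ v else zeroVec) ≡ (if b then u else zeroVec) ⊕ (if b then v else zeroVec)
if-⊕ true  u v = refl
if-⊕ false u v = sym (⊕-identityˡ _)

sumCols-if : ∀ {n r} (Y : Vec (GF2Vec n) r) b β →
             sumCols Y (if b then β else zeroVec) ≡ (if b then sumCols Y β else zeroVec)
sumCols-if Y true  β = refl
sumCols-if Y false β = sumCols-0 Y

span-if : ∀ {n l} (ws : Vec (GF2Vec n) l) b {v} → Span ws v → Span ws (if b then v else zeroVec)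
span-if ws true  sp = sp
span-if ws false _  = span-0 ws

n≤2^n : ∀ n → n ≤ 2 ^ n
n≤2^n zero    = z≤n
n≤2^n (suc n) = ℕₚ.+-mono-≤ (ℕₚ.m^n>0 2 n) (ℕₚ.≤-trans (n≤2^n n) (ℕₚ.m≤m+n (2 ^ n) 0))

-- Bernoulli with c = 4: L draws gain a factor 4, hence L * n draws gain 4^n.
4^n*K^ : ∀ K n → 4 ^ n * suc K ^ (4 * suc K * n) ≤ suc (suc K) ^ (4 * suc K * n)
4^n*K^ K n = begin
  4 ^ n * suc K ^ (L * n)          ≡⟨ cong (4 ^ n *_) (ℕₚ.^-*-assoc (suc K) L n) ⟨
  4 ^ n * (suc K ^ L) ^ n          ≡⟨ ^-distribʳ-* n 4 (suc K ^ L) ⟨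
  (4 * suc K ^ L) ^ n              ≤⟨ ℕₚ.^-monoˡ-≤ n (bernoulli-large (suc K) 4 L ℕₚ.≤-refl) ⟩
  (suc (suc K) ^ L) ^ n            ≡⟨ ℕₚ.^-*-assoc (suc (suc K)) L n ⟩
  suc (suc K) ^ (L * n)            ∎
  where open ℕₚ.≤-Reasoning
        L = 4 * suc K

-- Density 1/(D + 1) corresponds to K = 2D + 1, which is never 0, as `bernoulli-large` requires.
2D : ∀ D → suc (suc (D + D)) ≡ 2 * suc D
2D = solve-∀

-- Phase 1: the growing basis and its linkage.

module Process (r k₃ h z : ℕ) where

  open Phases r k₃ h z

  -- The tail is processed first, so the head of a sequence is the newest draw, as in
  -- `supermartingale`.
  basis : ∀ {t} → Vec Column t → Σ ℕ (Vec Column)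
  basis []      = 0 , []
  basis (c ∷ v) with fresh? (proj₂ (basis v)) c
  ... | yes _ = suc (proj₁ (basis v)) , c ∷ proj₂ (basis v)
  ... | no _  = basis v

  basis-indep : ∀ {t} (v : Vec Column t) → Indep (proj₂ (basis v))
  basis-indep []      = tt
  basis-indep (c ∷ v) with fresh? (proj₂ (basis v)) c
  ... | yes (_ , c∉) = c∉ , basis-indep v
  ... | no _         = basis-indep v

  Kernel : ∀ {l} → Vec Column l → Set
  Kernel ws = ∀ T → π (sumCols ws T) ≡ zeroVec

  kernel-∷ : ∀ {l} c (ws : Vec Column l) → π c ≡ zeroVec → Kernel ws → Kernel (c ∷ ws)
  kernel-∷ c ws πc ker (true  ∷ T) = trans (sumCols-⊕ labels c _) (trans (cong₂ _⊕_ πc (ker T)) (⊕-identityˡ _))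
  kernel-∷ c ws πc ker (false ∷ T) = trans (cong π (⊕-identityˡ _)) (ker T)

  basis-kernel : ∀ {t} (v : Vec Column t) → Kernel (proj₂ (basis v))
  basis-kernel []      [] = sumCols-0 labels
  basis-kernel (c ∷ v) with fresh? (proj₂ (basis v)) c
  ... | yes (πc , _) = kernel-∷ c _ πc (basis-kernel v)
  ... | no _         = basis-kernel v

  basis-pick : ∀ {t} (v : Vec Column t) → Pick v (proj₂ (basis v)) []
  basis-pick []      = []
  basis-pick (c ∷ v) with fresh? (proj₂ (basis v)) c
  ... | yes _ = ctr c (basis-pick v)
  ... | no _  = skip c (basis-pick v)

  basis-linked : ∀ {t} c (v : Vec Column t) → Linked (proj₂ (basis v)) → Linked (proj₂ (basis (c ∷ v)))
  basis-linked c v lk with fresh? (proj₂ (basis v)) c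
  ... | yes _ = linked-∷ c (proj₂ (basis v)) lk
  ... | no _  = lk

  unlinked? : ∀ {t} (v : Vec Column t) → Dec (¬ Linked (proj₂ (basis v)))
  unlinked? v = ¬? (linked? (proj₂ (basis v)))

  -- Each unit of rank still missing doubles the weight.
  weight : ∀ {t} → Vec Column t → ℕ
  weight v = 2 ^ (n ∸ proj₁ (basis v))

  weight-≤ : ∀ {t} c (v : Vec Column t) → weight (c ∷ v) ≤ weight v
  weight-≤ c v with fresh? (proj₂ (basis v)) c
  ... | yes _ = ℕₚ.^-monoʳ-≤ 2 (ℕₚ.∸-monoʳ-≤ n (ℕₚ.n≤1+n (proj₁ (basis v))))
  ... | no _  = ℕₚ.≤-refl

  weight-halves : ∀ {t} c (v : Vec Column t) → Fresh (proj₂ (basis v)) c → 2 * weight (c ∷ v) ≤ weight v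
  weight-halves c v fr with fresh? (proj₂ (basis v)) c | basis-indep (c ∷ v)
  ... | no ¬fr | _   = contradiction fr ¬fr
  -- The enlarged basis still has at most n vectors, so the truncated subtraction has not stopped at
  -- 0 and the exponent really drops by one.
  ... | yes _  | ind = ℕₚ.≤-reflexive (cong (2 ^_) (sym (ℕₚ.+-∸-assoc 1 (rank≤ _ ind))))

  -- Linked sequences weigh nothing. As linkage persists, their extensions weigh nothing either, and
  -- for unlinked ones `many-fresh` supplies the decrease.
  F : ∀ {t} → Vec Column t → ℕ
  F v = 𝟙 (unlinked? v) * weight v

  -- A weight is at least 1, so the count is at most the sum of `F`, which starts from at most 2^n.
  few-unlinked : ∀ D K → suc K ≡ 2 * D → length columns ≤ D * (a * (z C k₂) * (k * h)) → ∀ t →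
                 suc K ^ t * count unlinked? (seqs columns t) ≤ K ^ t * (length columns ^ t * 2 ^ n)
  few-unlinked D K 2D dense t = begin
    suc K ^ t * count unlinked? (seqs columns t)
      ≤⟨ ℕₚ.*-monoʳ-≤ (suc K ^ t) (sumOver-mono (seqs columns t) (λ v _ →
           ℕₚ.m≤m*n (𝟙 (unlinked? v)) (weight v) {{ℕₚ.m^n≢0 2 (n ∸ proj₁ (basis v))}})) ⟩
    suc K ^ t * sumOver F (seqs columns t)
      ≤⟨ supermartingale columns F K step t ⟩
    K ^ t * (length columns ^ t * F [])
      ≤⟨ ℕₚ.*-monoʳ-≤ (K ^ t) (ℕₚ.*-monoʳ-≤ (length columns ^ t) (F≤weight [])) ⟩
    K ^ t * (length columns ^ t * 2 ^ n) ∎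
    where
    open ℕₚ.≤-Reasoning
    F≤weight : ∀ {t} (v : Vec Column t) → F v ≤ weight v
    F≤weight v = ℕₚ.≤-trans (ℕₚ.*-monoˡ-≤ (weight v) (𝟙≤ (unlinked? v) (λ _ → ℕₚ.≤-refl)))
                            (ℕₚ.≤-reflexive (ℕₚ.*-identityˡ (weight v)))
    step : ∀ {t} (v : Vec Column t) → suc K * sumOver (λ c → F (c ∷ v)) columns ≤ K * (length columns * F v)
    step v with linked? (proj₂ (basis v))
    ... | yes lk = ℕₚ.≤-trans (ℕₚ.≤-reflexive (trans (cong (suc K *_) (trans
                     (sumOver-cong columns (λ c → cong (_* weight (c ∷ v)) (linked⇒0 c)))
                     (trans (sumOver-const 0 columns) (ℕₚ.*-zeroʳ (length columns))))) (ℕₚ.*-zeroʳ (suc K)))) z≤n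
      where
      linked⇒0 : ∀ c → 𝟙 (unlinked? (c ∷ v)) ≡ 0
      linked⇒0 c = 𝟙-no (unlinked? (c ∷ v)) (λ ¬lk → ¬lk (basis-linked c v lk))
    ... | no ¬lk = subst (λ w → suc K * sumOver (λ c → F (c ∷ v)) columns ≤ K * (length columns * w))
                     (sym (ℕₚ.*-identityˡ (weight v)))
                     (average-decrease (fresh? (proj₂ (basis v))) (λ c → F (c ∷ v)) columns D K (weight v) 2D
                       (λ c → ℕₚ.≤-trans (F≤weight (c ∷ v)) (weight-≤ c v))
                       (λ c fr → ℕₚ.≤-trans (ℕₚ.*-monoʳ-≤ 2 (F≤weight (c ∷ v))) (weight-halves c v fr))
                       (ℕₚ.≤-trans dense (ℕₚ.*-monoʳ-≤ D (many-fresh (proj₂ (basis v)) ¬lk))))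

  -- These draws gain a factor 4^n: one 2^n pays for the initial weight, the other is at least n and
  -- hence at least 2q.
  exp-few-unlinked : ∀ D q → length columns ≤ suc D * (a * (z C k₂) * (k * h)) → 2 * q ≤ n →
    let t = 4 * suc (D + D) * n in 2 * q * count unlinked? (seqs columns t) ≤ length columns ^ t
  exp-few-unlinked D q dense 2q≤n = ℕₚ.≤-trans (ℕₚ.*-monoˡ-≤ bad (ℕₚ.≤-trans 2q≤n (n≤2^n n)))
    (ℕₚ.*-cancelˡ-≤ (2 ^ n) {{ℕₚ.m^n≢0 2 n}} (ℕₚ.*-cancelˡ-≤ (K ^ t) {{ℕₚ.m^n≢0 K t}} (begin
      K ^ t * (2 ^ n * (2 ^ n * bad))   ≡⟨ e₁ (K ^ t) (2 ^ n) bad ⟩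
      2 ^ n * 2 ^ n * K ^ t * bad       ≡⟨ cong (λ x → x * K ^ t * bad) (^-distribʳ-* n 2 2) ⟨
      4 ^ n * K ^ t * bad               ≤⟨ ℕₚ.*-monoˡ-≤ bad (4^n*K^ (D + D) n) ⟩
      suc K ^ t * bad                   ≤⟨ few-unlinked (suc D) K (2D D) dense t ⟩
      K ^ t * (Ω ^ t * 2 ^ n)           ≡⟨ cong (K ^ t *_) (ℕₚ.*-comm (Ω ^ t) (2 ^ n)) ⟩
      K ^ t * (2 ^ n * Ω ^ t)           ∎)))
    where
    open ℕₚ.≤-Reasoning
    K t Ω bad : ℕ
    K = suc (D + D)
    t = 4 * K * n
    Ω = length columns
    bad = count unlinked? (seqs columns t)
    e₁ : ∀ k x b → k * (x * (x * b)) ≡ x * x * k * b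
    e₁ = solve-∀

  -- Phase 2: the minor obtained from the targets.

  module _ {l} {ws : Vec Column l} (lk : Linked ws) where
    open Targets ws lk

    -- The column hitting the target 0 is congruent to κ, so contracting it
    -- makes every target β congruent to sumCols Y β, which is linear in β.
    targets⇒minor : ∀ {t m e} (B : Vec (GF2Vec r) e) (v : Vec Column t) {cols : Vec Column m} →
                    Pick cols ws [] → Indep ws → Kernel ws →
                    Hits {P = Target} (zeroVec ∷ toList B) v →
                    IsMinorOf (columnMatroid B) (columnMatroid (v ++ cols))
    targets⇒minor {e = e} B v p ind ker hits = finish (first v p hits)
      where
      Contracted : ∀ {m} → Vec Column m → Set
      Contracted cols = Σ ℕ λ l′ → Σ (Vec Column l′) λ ws′ → Σ (Vec Column e) λ vs →
        Pick cols ws′ vs × Indep ws′ × Kernel ws′ × (∀ {u} → Span ws u → Span ws′ u) × Span ws′ κ × Pointwise Target B vs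

      ≡κ : ∀ {c} → Span ws (c ⊕ (κ ⊕ sumCols Y zeroVec)) → Span ws (c ⊕ κ)
      ≡κ {c} = subst (λ u → Span ws (c ⊕ u)) (trans (cong (κ ⊕_) (sumCols-0 Y)) (⊕-identityʳ κ))

      first : ∀ {t m} (v : Vec Column t) {cols : Vec Column m} → Pick cols ws [] →
              Hits {P = Target} (zeroVec ∷ toList B) v → Contracted (v ++ cols)
      first (c ∷ v) p (inj₂ hits) with first v p hits
      ... | l′ , ws′ , vs , p′ , rest = l′ , ws′ , vs , skip c p′ , rest
      -- The column hitting 0 may already lie in the span; it is then deleted instead of contracted.
      -- In both cases `κ` ends up in the new span.
      first (c ∷ v) p (inj₁ ((πc , sp) , hits)) with pick-hits B v p hits | span? ws c
      ... | vs , p′ , all | yes c∈ =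
        _ , ws , vs , skip c p′ , ind , ker , (λ s → s) ,
        subst (Span ws) (⊕-cancelˡ c κ) (span-⊕ ws c∈ (≡κ sp)) , all
      ... | vs , p′ , all | no c∉ =
        _ , c ∷ ws , vs , ctr c p′ , (c∉ , ind) , kernel-∷ c ws πc ker , span-∷ c ws ,
        subst (Span (c ∷ ws)) (⊕-cancelˡ c κ) (span-⊕ (c ∷ ws) (span-head c ws) (span-∷ c ws (≡κ sp))) , all

      finish : ∀ {m} {cols : Vec Column m} → Contracted cols → IsMinorOf (columnMatroid B) (columnMatroid cols)
      finish (l′ , ws′ , vs , p , ind′ , ker′ , ws⊆ , κ∈ , all) =
        pick⇒minor B p ind′ labels ker′ (label all) relation
        where
        label : ∀ {e} {B : Vec (GF2Vec r) e} {vs : Vec Column e} → Pointwise Target B vs →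
                ∀ S → π (sumCols vs S) ≡ sumCols B S
        label []                   []      = sumCols-0 labels
        label {B = β ∷ B} {v ∷ vs} ((πv , _) ∷ all) (s ∷ S) = trans (sumCols-⊕ labels _ _)
          (cong₂ _⊕_ (trans (sumCols-if labels s v) (cong (λ u → if s then u else zeroVec) πv)) (label all S))

        -- Adding `κ`, now in the span, removes the common offset.
        congruent : ∀ {β v} → Target β v → Span ws′ (v ⊕ sumCols Y β)
        congruent {β} {v} (_ , sp) = subst (Span ws′) cancel (span-⊕ ws′ (ws⊆ sp) κ∈)
          where
          open ≡-Reasoning
          cancel : (v ⊕ (κ ⊕ sumCols Y β)) ⊕ κ ≡ v ⊕ sumCols Y β
          cancel = begin
            (v ⊕ (κ ⊕ sumCols Y β)) ⊕ κ  ≡⟨ ⊕-assoc v _ κ ⟩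
            v ⊕ ((κ ⊕ sumCols Y β) ⊕ κ)  ≡⟨ cong (v ⊕_) (⊕-comm _ κ) ⟩
            v ⊕ (κ ⊕ (κ ⊕ sumCols Y β))  ≡⟨ cong (v ⊕_) (⊕-cancelˡ κ _) ⟩
            v ⊕ sumCols Y β              ∎

        congruent-sum : ∀ {e} {B : Vec (GF2Vec r) e} {vs : Vec Column e} → Pointwise Target B vs →
                        ∀ S → Span ws′ (sumCols vs S ⊕ sumCols Y (sumCols B S))
        congruent-sum []                   []      =
          subst (Span ws′) (sym (trans (⊕-identityˡ _) (sumCols-0 Y))) (span-0 ws′)
        congruent-sum {B = β ∷ B} {v ∷ vs} (target ∷ all) (s ∷ S) =
          subst (Span ws′) regroup (span-⊕ ws′ (span-if ws′ s (congruent target)) (congruent-sum all S))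
          where
          open ≡-Reasoning
          s·v s·Y : Column
          s·v = if s then v else zeroVec
          s·Y = if s then sumCols Y β else zeroVec
          Σv = sumCols vs S
          regroup : (if s then v ⊕ sumCols Y β else zeroVec) ⊕ (Σv ⊕ sumCols Y (sumCols B S))
                    ≡ (s·v ⊕ Σv) ⊕ sumCols Y ((if s then β else zeroVec) ⊕ sumCols B S)
          regroup = begin
            (if s then v ⊕ sumCols Y β else zeroVec) ⊕ (Σv ⊕ sumCols Y (sumCols B S))
              ≡⟨ cong (_⊕ _) (if-⊕ s v (sumCols Y β)) ⟩
            (s·v ⊕ s·Y) ⊕ (Σv ⊕ sumCols Y (sumCols B S))
              ≡⟨ ⊕-interchange s·v s·Y Σv _ ⟩
            (s·v ⊕ Σv) ⊕ (s·Y ⊕ sumCols Y (sumCols B S))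
              ≡⟨ cong (λ u → (s·v ⊕ Σv) ⊕ (u ⊕ sumCols Y (sumCols B S))) (sumCols-if Y s β) ⟨
            (s·v ⊕ Σv) ⊕ (sumCols Y (if s then β else zeroVec) ⊕ sumCols Y (sumCols B S))
              ≡⟨ cong ((s·v ⊕ Σv) ⊕_) (sumCols-⊕ Y _ _) ⟨
            (s·v ⊕ Σv) ⊕ sumCols Y ((if s then β else zeroVec) ⊕ sumCols B S) ∎

        -- A relation of `B` makes the `Y` part vanish, so the kept columns sum into the span.
        relation : ∀ S → sumCols B S ≡ zeroVec → Span ws′ (sumCols vs S)
        relation S eq = subst (Span ws′) (trans (cong (sumCols vs S ⊕_) (trans (cong (sumCols Y) eq) (sumCols-0 Y))) (⊕-identityʳ _))
          (congruent-sum all S)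

  -- Counting the good outcomes.

  module _ {e} (B : Vec (GF2Vec r) e) where

    targets : List (GF2Vec r)
    targets = zeroVec ∷ toList B

    -- The targets are defined from a particular proof of linkage, so the decision itself is an
    -- argument; an unlinked phase 1 counts as failure.
    Good′ : ∀ {t l} (ws : Vec Column l) → Dec (Linked ws) → Vec Column t → Set
    Good′ ws (yes lk) v = Hits {P = Targets.Target ws lk} targets v
    Good′ ws (no _)   v = Empty

    good′? : ∀ {t l} (ws : Vec Column l) (lk? : Dec (Linked ws)) (v : Vec Column t) → Dec (Good′ ws lk? v)
    good′? ws (yes lk) v = hits? (Targets.target? ws lk) targets v
    good′? ws (no _)   v = no λ ()

    Good : ∀ {m₁ m₂} → Vec Column m₁ × Vec Column m₂ → Set
    Good (u , v) = Good′ (proj₂ (basis u)) (linked? (proj₂ (basis u))) v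

    good? : ∀ {m₁ m₂} (uv : Vec Column m₁ × Vec Column m₂) → Dec (Good uv)
    good? (u , v) = good′? (proj₂ (basis u)) (linked? (proj₂ (basis u))) v

    good⇒minor : ∀ {m₁ m₂} (u : Vec Column m₁) (v : Vec Column m₂) → Good (u , v) →
                 IsMinorOf (columnMatroid B) (columnMatroid (v ++ u))
    good⇒minor u v = go (linked? (proj₂ (basis u)))
      where
      go : (lk? : Dec (Linked (proj₂ (basis u)))) → Good′ (proj₂ (basis u)) lk? v →
           IsMinorOf (columnMatroid B) (columnMatroid (v ++ u))
      go (yes lk) good = targets⇒minor {ws = proj₂ (basis u)} lk B v (basis-pick u) (basis-indep u) (basis-kernel u) good
      go (no _)   ()

    -- The bound for phase 2 conditional on phase 1. It is uniform over all linked `ws`, so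
    -- independence of the phases amounts to summing over pairs.
    FewMisses : ℕ → ℕ → Set
    FewMisses q m = ∀ {l} (ws : Vec Column l) (lk : Linked ws) →
      2 * q * count (λ v → ¬? (hits? (Targets.target? ws lk) targets v)) (seqs columns m) ≤ length columns ^ m

    -- There are e + 1 targets, which gives the factor 2^(e + 1); the required number of draws does
    -- not grow with n if D is fixed.
    few-missed : ∀ D q m → length columns ≤ D * h ^ k → 2 * q * 2 ^ suc e * suc (D + D) ≤ m → FewMisses q m
    few-missed D q m dense large ws lk =
      ℕₚ.*-cancelˡ-≤ (2 ^ suc e) {{ℕₚ.m^n≢0 2 (suc e)}} (ℕₚ.*-cancelˡ-≤ (K ^ m) {{ℕₚ.m^n≢0 K m}} (begin
        K ^ m * (2 ^ suc e * (2 * q * missed))     ≡⟨ e₁ (K ^ m) (2 ^ suc e) (2 * q) missed ⟩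
        2 * q * 2 ^ suc e * K ^ m * missed         ≤⟨ ℕₚ.*-monoˡ-≤ missed (bernoulli-large K (2 * q * 2 ^ suc e) m large) ⟩
        suc K ^ m * missed                         ≤⟨ few-misses target? columns (suc D) K (2D D) dense′ m targets ⟩
        K ^ m * (Ω ^ m * 2 ^ length targets)       ≡⟨ cong (λ l → K ^ m * (Ω ^ m * 2 ^ suc l)) (length-toList B) ⟩
        K ^ m * (Ω ^ m * 2 ^ suc e)                ≡⟨ cong (K ^ m *_) (ℕₚ.*-comm (Ω ^ m) (2 ^ suc e)) ⟩
        K ^ m * (2 ^ suc e * Ω ^ m)                ∎))
      where
      open ℕₚ.≤-Reasoning
      open Targets ws lk using (target?; many-targets)
      K Ω missed : ℕ
      K = suc (D + D)
      Ω = length columns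
      missed = count (λ v → ¬? (hits? target? targets v)) (seqs columns m)
      e₁ : ∀ a b c d → a * (b * (c * d)) ≡ c * b * a * d
      e₁ = solve-∀
      dense′ : ∀ β → Ω ≤ suc D * count (target? β) columns
      dense′ β = ℕₚ.≤-trans dense (ℕₚ.*-mono-≤ (ℕₚ.n≤1+n D) (many-targets β))

    -- Union bound: each phase fails on at most a 1/(2q) share of the outcomes.
    many-good : ∀ q m₁ m₂ → 2 * q * count unlinked? (seqs columns m₁) ≤ length columns ^ m₁ → FewMisses q m₂ →
                q * (length columns ^ (m₂ + m₁)) ≤
                q * count good? (cartesianProduct (seqs columns m₁) (seqs columns m₂)) + length columns ^ (m₂ + m₁)
    many-good q m₁ m₂ few₁ few₂ = ℕₚ.*-cancelˡ-≤ 2 (begin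
      2 * (q * N ^ (m₂ + m₁))                 ≡⟨ cong (λ x → 2 * (q * x)) (ℕₚ.^-distribˡ-+-* N m₂ m₁) ⟩
      2 * (q * (N₂ * N₁))                     ≡⟨ e₁ q N₂ N₁ ⟩
      N₁ * (2 * q * N₂)                       ≡⟨ trans (sumOver-const _ us) (cong (_* (2 * q * N₂)) (length-seqs columns m₁)) ⟨
      sumOver (λ _ → 2 * q * N₂) us           ≤⟨ sumOver-mono us (λ u _ → each u) ⟩
      sumOver (λ u → 2 * q * g u + (2 * q * N₂ * 𝟙 (unlinked? u) + N₂)) us
        ≡⟨ trans (sumOver-+ _ _ us) (cong (sumOver (λ u → 2 * q * g u) us +_) (sumOver-+ _ _ us)) ⟩
      sumOver (λ u → 2 * q * g u) us + (sumOver (λ u → 2 * q * N₂ * 𝟙 (unlinked? u)) us + sumOver (λ _ → N₂) us)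
        ≡⟨ cong₂ _+_ (sumOver-* g (2 * q) us) (cong₂ _+_ (sumOver-* _ (2 * q * N₂) us)
             (trans (sumOver-const N₂ us) (cong (_* N₂) (length-seqs columns m₁)))) ⟩
      2 * q * sumOver g us + (2 * q * N₂ * bad + N₁ * N₂)
        ≡⟨ e₂ q (sumOver g us) N₂ bad N₁ ⟩
      2 * (q * sumOver g us) + ((2 * q * bad) * N₂ + N₁ * N₂)
        ≤⟨ ℕₚ.+-monoʳ-≤ (2 * (q * sumOver g us)) (ℕₚ.+-monoˡ-≤ (N₁ * N₂) (ℕₚ.*-monoˡ-≤ N₂ few₁)) ⟩
      2 * (q * sumOver g us) + (N₁ * N₂ + N₁ * N₂)
        ≡⟨ e₃ (q * sumOver g us) N₁ N₂ ⟩
      2 * (q * sumOver g us + N₂ * N₁)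
        ≡⟨ cong₂ (λ x y → 2 * (q * x + y)) (sumOver-product _ _,_ us vs) (ℕₚ.^-distribˡ-+-* N m₂ m₁) ⟨
      2 * (q * count good? (cartesianProduct us vs) + N ^ (m₂ + m₁)) ∎)
      where
      open ℕₚ.≤-Reasoning
      N = length columns
      N₁ = N ^ m₁
      N₂ = N ^ m₂
      us = seqs columns m₁
      vs = seqs columns m₂
      bad = count unlinked? us
      g : Vec Column m₁ → ℕ
      g u = count (λ v → good? (u , v)) vs
      e₁ : ∀ q x y → 2 * (q * (x * y)) ≡ y * (2 * q * x)
      e₁ = solve-∀
      e₂ : ∀ q s x b y → 2 * q * s + (2 * q * x * b + y * x) ≡ 2 * (q * s) + (2 * q * b * x + y * x)
      e₂ = solve-∀
      e₃ : ∀ x a b → 2 * x + (a * b + a * b) ≡ 2 * (x + b * a)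
      e₃ = solve-∀
      each′ : ∀ {l} (ws : Vec Column l) (lk? : Dec (Linked ws)) →
              2 * q * N₂ ≤ 2 * q * count (good′? ws lk?) vs + (2 * q * N₂ * 𝟙 (¬? lk?) + N₂)
      -- Without linkage the indicator is 1, and its term alone covers the left side.
      each′ ws (no ¬lk) = ℕₚ.≤-trans (ℕₚ.≤-reflexive (sym (ℕₚ.*-identityʳ (2 * q * N₂))))
        (ℕₚ.≤-trans (ℕₚ.m≤m+n _ N₂) (ℕₚ.m≤n+m _ (2 * q * count (good′? ws (no ¬lk)) vs)))
      each′ ws (yes lk) = begin
        2 * q * N₂                                      ≡⟨ cong (2 * q *_) (trans (count-¬ hit? vs) (length-seqs columns m₂)) ⟨
        2 * q * (count hit? vs + count (λ v → ¬? (hit? v)) vs)  ≡⟨ ℕₚ.*-distribˡ-+ (2 * q) (count hit? vs) _ ⟩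
        2 * q * count hit? vs + 2 * q * count (λ v → ¬? (hit? v)) vs
          ≤⟨ ℕₚ.+-monoʳ-≤ (2 * q * count hit? vs) (ℕₚ.≤-trans (few₂ ws lk) (ℕₚ.m≤n+m N₂ (2 * q * N₂ * 0))) ⟩
        2 * q * count hit? vs + (2 * q * N₂ * 0 + N₂) ∎
        where
        hit? : ∀ v → Dec (Hits {P = Targets.Target ws lk} targets v)
        hit? v = hits? (Targets.target? ws lk) targets v
      each : ∀ u → 2 * q * N₂ ≤ 2 * q * g u + (2 * q * N₂ * 𝟙 (unlinked? u) + N₂)
      each u = each′ (proj₂ (basis u)) (linked? (proj₂ (basis u)))

    prob-minor : ∀ p q m₁ m₂ → 0 < p → 2 * q * count unlinked? (seqs columns m₁) ≤ length columns ^ m₁ →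
                 FewMisses q m₂ → ProbMinorAtLeast (columnMatroid B) n (m₂ + m₁) k p q
    prob-minor p q m₁ m₂ 0<p few₁ few₂ = goods , goods-unique , ListAll.tabulate goods-good , (begin
      q * (n C k) ^ (m₂ + m₁)                        ≡⟨ cong (λ x → q * x ^ (m₂ + m₁)) (length-subsetsOfSize n k) ⟨
      q * length columns ^ (m₂ + m₁)                 ≤⟨ many-good q m₁ m₂ few₁ few₂ ⟩
      q * count good? pairs + length columns ^ (m₂ + m₁)
        ≡⟨ cong₂ (λ x y → q * x + y ^ (m₂ + m₁))
             (trans (sym (length-filter≡count good? pairs)) (sym (length-map join (filter good? pairs))))
             (length-subsetsOfSize n k) ⟩
      q * length goods + (n C k) ^ (m₂ + m₁)
        -- The error 1/q is at most p/q because p is positive.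
        ≤⟨ ℕₚ.+-monoʳ-≤ (q * length goods) (ℕₚ.m≤n*m _ p {{>-nonZero 0<p}}) ⟩
      q * length goods + p * (n C k) ^ (m₂ + m₁)     ∎)
      where
      open ℕₚ.≤-Reasoning
      pairs : List (Vec Column m₁ × Vec Column m₂)
      pairs = cartesianProduct (seqs columns m₁) (seqs columns m₂)
      join : Vec Column m₁ × Vec Column m₂ → Vec Column (m₂ + m₁)
      join (u , v) = v ++ u
      goods : List (Vec Column (m₂ + m₁))
      goods = map join (filter good? pairs)
      join-injective : ∀ {x y} → join x ≡ join y → x ≡ y
      join-injective {u , v} {u′ , v′} eq with ++-injective v v′ eq
      ... | refl , refl = refl
      goods-unique : Unique goods
      goods-unique = Uniqueₚ.map⁺ join-injective (Uniqueₚ.filter⁺ good?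
        (Uniqueₚ.cartesianProduct⁺ (seqs-unique (subsetsOfSize-unique n k) m₁) (seqs-unique (subsetsOfSize-unique n k) m₂)))
      size-k : ∀ {t} {v : Vec Column t} → v ∈ₗ seqs columns t → VecAll.All (λ s → ∣ s ∣ ≡ k) v
      size-k {t} v∈ = VecAll.map (subsetsOfSize⁻ n k) (seqs⁻ columns t v∈)
      goods-good : ∀ {cols} → cols ∈ₗ goods →
                   VecAll.All (λ s → ∣ s ∣ ≡ k) cols × IsMinorOf (columnMatroid B) (columnMatroid cols)
      goods-good cols∈ with ∈ₚ.∈-map⁻ join cols∈
      ... | (u , v) , uv∈ , refl with ∈ₚ.∈-filter⁻ good? {xs = pairs} uv∈
      ...   | uv∈pairs , good with ∈ₚ.∈-cartesianProduct⁻ (seqs columns m₁) (seqs columns m₂) uv∈pairs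
      ...     | u∈ , v∈ = VecAllₚ.++⁺ (size-k v∈) (size-k u∈) , good⇒minor u v good

-- Choice of the constants and of the threshold for n.

theorem1 : (r e : ℕ) (B : Vec (Subset r) e) →
    ∃ λ kM → ∃ λ LM →
    ∀ k → kM ≤ k →
    ∀ (m : ℕ → ℕ) → (∀ n → LM * n ≤ m n) →
    ∀ p q → 0 < p →
    ∃ λ N → ∀ n → N ≤ n →
    ProbMinorAtLeast (columnMatroid B) n (m n) k p q
-- With k = r + 2 + k₃ a target has one position per coordinate of GF(2)^r and at least two points
-- in block 0. Of the columns, L * n go to phase 1 and at least n to phase 2.
theorem1 r e B = suc (suc r) , L + 1 , large-k
  where
  R D₁ L : ℕ
  R  = suc r
  D₁ = 512 * R * R
  L  = 4 * suc (D₁ + D₁)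

  large-k : ∀ k → suc (suc r) ≤ k → (m : ℕ → ℕ) → (∀ n → (L + 1) * n ≤ m n) → ∀ p q → 0 < p →
            ∃ λ N → ∀ n → N ≤ n → ProbMinorAtLeast (columnMatroid B) n (m n) k p q
  large-k k kM≤k m LM≤m p q 0<p with ℕₚ.m≤n⇒∃[o]m+o≡n kM≤k
  -- `N₁` makes the blocks nonempty, 2q bounds the error of phase 1 and `N₂` that of phase 2.
  ... | k₃ , refl = N₁ + 2 * q + N₂ , λ n N≤n → large-n (m n) (LM≤m n)
      (ℕₚ.≤-trans (ℕₚ.≤-trans (ℕₚ.m≤n+m (2 * q) N₁) (ℕₚ.m≤m+n _ N₂)) N≤n)
      (ℕₚ.≤-trans (ℕₚ.m≤n+m N₂ (N₁ + 2 * q)) N≤n)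
      (layout r (suc (r + k₃)) n (ℕₚ.≤-trans (ℕₚ.≤-trans (ℕₚ.m≤m+n N₁ (2 * q)) (ℕₚ.m≤m+n _ N₂)) N≤n))
    where
    D₂ N₁ N₂ : ℕ
    D₂ = (16 * R * k * k) ^ k
    N₁ = 8 * R * k * k
    N₂ = 2 * q * 2 ^ suc e * suc (D₂ + D₂)

    large-n : ∀ {n} M → (L + 1) * n ≤ M → 2 * q ≤ n → N₂ ≤ n → Layout R k n →
              ProbMinorAtLeast (columnMatroid B) n M k p q
    large-n {n} M LM≤M 2q≤n N₂≤n lay@record { h = h ; z = z ; total = refl } with ℕₚ.m≤n⇒∃[o]m+o≡n LM≤M
    -- Phase 1 has a fixed length, so the surplus `o` is given to phase 2, whose bound holds for
    -- every sufficiently large number of draws.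
    ... | o , refl = subst (λ M → ProbMinorAtLeast (columnMatroid B) n M k p q) (split L n o)
      (prob-minor B p q (L * n) (n + o) 0<p
        (exp-few-unlinked D₁ q dense₁ 2q≤n)
        (few-missed B D₂ q (n + o) dense₂ (ℕₚ.≤-trans N₂≤n (ℕₚ.m≤m+n n o))))
      where
      open Process r k₃ h z
      open Phases r k₃ h z using (columns; a; k₂)
      split : ∀ L n o → n + o + L * n ≡ (L + 1) * n + o
      split = solve-∀
      dense₁ : length columns ≤ suc D₁ * (a * (z C k₂) * (k * h))
      dense₁ = ℕₚ.≤-trans (ℕₚ.≤-reflexive (length-subsetsOfSize n k))
        (ℕₚ.≤-trans (layout-kernel-density lay) (ℕₚ.m≤n+m _ (a * (z C k₂) * (k * h))))
      dense₂ : length columns ≤ D₂ * h ^ k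
      dense₂ = ℕₚ.≤-trans (ℕₚ.≤-reflexive (length-subsetsOfSize n k)) (layout-transversal-density lay)
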